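{- There exists $k_0$ such that for all integers $k \ge k_0$, \[ r_k(\mathcal{L}) < 1.546\, k. \]
   Context: A 3-uniform hypergraph is a set of 3-element subsets (triples) of a vertex set. The loose path $\mathcal{L}$ is the 3-uniform hypergraph $\{abc, cde, efg\}$ on seven distinct vertices $a,b,c,d,e,f,g$. For a 3-uniform hypergraph $\mathcal{H}$, the multicolor Ramsey number $r_k(\mathcal{H})$ is the smallest integer $n$ such that every coloring of $\binom{[n]}{3}$ with $k$ colors contains a monochromatic copy of $\mathcal{H}$. -}

module Defs where

open import Data.Nat using (ℕ)
open import Data.Fin using (Fin; _<_)
open import Data.Product using (Σ; ∃; _×_)
open import Relation.Binary.PropositionalEquality using (_≡_)
open import Function.Definitions using (Injective)

-- A k-colouring of the 3-element subsets of Fin n ([n] up to relabelling).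
-- A 3-subset is represented by its unique increasing listing p < q < r.
Colouring : ℕ → ℕ → Set
Colouring n k = (p q r : Fin n) → p < q → q < r → Fin k

data IsPerm {n : ℕ} (x y z : Fin n) : Fin n → Fin n → Fin n → Set where
  xyz : IsPerm x y z x y z
  xzy : IsPerm x y z x z y
  yxz : IsPerm x y z y x z
  yzx : IsPerm x y z y z x
  zxy : IsPerm x y z z x y
  zyx : IsPerm x y z z y x

EdgeHasColour : {n k : ℕ} → Colouring n k → Fin k → Fin n → Fin n → Fin n → Set
EdgeHasColour χ i x y z =
  ∃ λ p → ∃ λ q → ∃ λ r → Σ (p < q) λ pq → Σ (q < r) λ qr →
    IsPerm x y z p q r × (χ p q r pq qr ≡ i)

HasMonoLoosePath : {n k : ℕ} → Colouring n k → Set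
HasMonoLoosePath {n} {k} χ =
  Σ (Fin 7 → Fin n) λ v → Injective _≡_ _≡_ v × (∃ λ (i : Fin k) →
    EdgeHasColour χ i (v (# 0)) (v (# 1)) (v (# 2)) ×
    EdgeHasColour χ i (v (# 2)) (v (# 3)) (v (# 4)) ×
    EdgeHasColour χ i (v (# 4)) (v (# 5)) (v (# 6)))
  where open import Data.Fin using (#_)

Arrows : ℕ → ℕ → Set
Arrows n k = (χ : Colouring n k) → HasMonoLoosePath χ

module Submission where

-- In a colour class without a loose path all but few edges have one of two shapes, read off
-- the heavy pairs (pairs of large codegree): for a partial function x ↦ "the only heavy
-- neighbour of x", either two vertices of the edge are mapped to the third (a star edge), or
-- two of them are mapped to each other and the third has no image (a page of a book).
--
-- Write x ⇒ y if y is the image of x in some colour; every vertex emits at most k arrows.  A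
-- pair with no arrow has codegree at most 1 in each colour, so (n being larger than k) almost
-- every pair carries an arrow.  If the only arrow at {x, y} is x ⇒ y, of colour c, then the
-- n − |star| triples xyz with z outside the star of y in colour c use up distinct colours at x.
-- The set X of all such x for fixed c and y therefore emits few arrows into itself.  On X the
-- one-way arrows contain no directed triangle, and the easy bound 2/5 of Caccetta–Häggkvist
-- type gives 3|X| ≤ 5(|star| + k − n) up to an error.  In particular a colour has at most two
-- such y ("slots"), since n − k > n/3.
--
-- Give weight 1 to the slots of the one-slot colours and weight 2 to all other vertices, and
-- count arrows by the weight of their tail.  A pair with weights α, β costs at least αβ, except
-- for the only arrow of a pair ending in a vertex of weight 2, which is bounded by the previous
-- estimate in the two-slot colours.  For n = 17 k / 11 the total exceeds k times the total weight.

open import Defs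
open import Data.Nat using (ℕ; zero; suc; _+_; _*_; _∸_; _≤_; _<_; _≥_; z≤n; s≤s; _≤?_; _<?_; _/_; _%_; NonZero; >-nonZero)
open import Data.Product using (Σ; ∃; ∃₂; _×_; _,_; proj₁; proj₂)
open import Data.Bool using (if_then_else_)
open import Data.Empty using (⊥; ⊥-elim)
open import Data.Fin using (Fin; zero; suc; _≟_)
open import Data.Fin.Properties using (any?; all?)
import Data.Fin as Fin
import Data.Fin.Properties as Fin
open import Data.List using (List; []; _∷_; length)
import Data.List.Membership.DecPropositional as DecMembership
open import Data.List.Membership.Propositional using (_∈_)
open import Data.List.Relation.Unary.All as All using (All; []; _∷_)
open import Data.List.Relation.Unary.All.Properties using (¬Any⇒All¬)
open import Data.List.Relation.Unary.Any using (here; there)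
open import Data.Nat.DivMod using (m/n*n≤m; m%n<n; m≡m%n+[m/n]*n; /-monoˡ-≤; m*n/n≡m)
open import Data.Nat.Properties hiding (_≟_)
import Data.Nat.Properties as ℕ
open import Data.Nat.Tactic.RingSolver using (solve-∀)
open import Data.Sum using (_⊎_; inj₁; inj₂)
open import Data.Vec using ([]; _∷_; lookup)
open import Data.Vec.Relation.Unary.All using ([]; _∷_)
open import Data.Vec.Relation.Unary.AllPairs using ([]; _∷_)
open import Data.Vec.Relation.Unary.Unique.Propositional using (Unique)
open import Data.Vec.Relation.Unary.Unique.Propositional.Properties using (lookup-injective)
open import Function using (_∘_; flip)
open import Relation.Binary.Definitions using (tri<; tri≈; tri>)
open import Relation.Binary.PropositionalEquality using (_≡_; _≢_; refl; sym; trans; cong; cong₂; subst; ≢-sym; module ≡-Reasoning)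
open import Relation.Nullary using (¬_; Dec; yes; no; contradiction; does; Irrelevant)
open import Relation.Nullary.Decidable using (_×-dec_; _⊎-dec_; ¬?; decidable-stable; map′)

-- Finite sums and counting

-- Linear inequalities are derived as a ring identity L + B + s ≡ R + A
-- from a combination A ≤ B of known ones, s being the slack.
linear : ∀ {A B} L R s → A ≤ B → L + B + s ≡ R + A → L ≤ R
linear {A} {B} L R s A≤B eq = +-cancelʳ-≤ B L R (begin
  L + B      ≤⟨ m≤m+n (L + B) s ⟩
  L + B + s  ≡⟨ eq ⟩
  R + A      ≤⟨ +-monoʳ-≤ R A≤B ⟩
  R + B      ∎)
  where open ≤-Reasoning

ι : {P : Set} → Dec P → ℕ
ι d = if does d then 1 else 0

module _ {P : Set} where

  ι≤ : ∀ (d : Dec P) {m} → (P → 1 ≤ m) → ι d ≤ m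
  ι≤ (yes p) f = f p
  ι≤ (no  _) f = z≤n

  1≤ι : ∀ (d : Dec P) → P → 1 ≤ ι d
  1≤ι (yes _) p = ≤-refl
  1≤ι (no ¬p) p = contradiction p ¬p

  ι≤1 : ∀ (d : Dec P) → ι d ≤ 1
  ι≤1 d = ι≤ d (λ _ → ≤-refl)

  ι-no : ∀ (d : Dec P) → ¬ P → ι d ≡ 0
  ι-no d ¬p = n≤0⇒n≡0 (ι≤ d (⊥-elim ∘ ¬p))

  ι*-mono : ∀ (d : Dec P) {a b} → (P → a ≤ b) → ι d * a ≤ ι d * b
  ι*-mono (yes p) f = *-monoʳ-≤ 1 (f p)
  ι*-mono (no  _) f = z≤n

  ι*≤ : ∀ (d : Dec P) {a b} → (P → a ≤ b) → ι d * a ≤ b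
  ι*≤ (yes p) {a} f = ≤-trans (≤-reflexive (*-identityˡ a)) (f p)
  ι*≤ (no  _) f = z≤n

  ι+ι¬ : ∀ (d : Dec P) → ι d + ι (¬? d) ≡ 1
  ι+ι¬ (yes _) = refl
  ι+ι¬ (no  _) = refl

ι-mono : ∀ {P Q : Set} (p : Dec P) (q : Dec Q) → (P → Q) → ι p ≤ ι q
ι-mono p q f = ι≤ p (1≤ι q ∘ f)

module _ {P Q : Set} where

  ι-cong : ∀ (p : Dec P) (q : Dec Q) → (P → Q) → (Q → P) → ι p ≡ ι q
  ι-cong p q f g = ≤-antisym (ι-mono p q f) (ι-mono q p g)

  ι-⊎ : ∀ (p : Dec P) (q : Dec Q) → ι (p ⊎-dec q) ≤ ι p + ι q
  ι-⊎ (yes _) q = s≤s z≤n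
  ι-⊎ (no  _) q = ≤-refl

  ι-× : ∀ (p : Dec P) (q : Dec Q) → ι (p ×-dec q) ≡ ι p * ι q
  ι-× (yes _) q = sym (+-identityʳ _)
  ι-× (no  _) q = refl

sum : ∀ {n} → (Fin n → ℕ) → ℕ
sum {zero}  f = 0
sum {suc n} f = f zero + sum (f ∘ suc)

sum-cong : ∀ {n} {f g : Fin n → ℕ} → (∀ i → f i ≡ g i) → sum f ≡ sum g
sum-cong {zero}  f≡g = refl
sum-cong {suc n} f≡g = cong₂ _+_ (f≡g zero) (sum-cong (f≡g ∘ suc))

sum-+ : ∀ {n} (f g : Fin n → ℕ) → sum (λ i → f i + g i) ≡ sum f + sum g
sum-+ {zero}  f g = refl
sum-+ {suc n} f g = trans (cong (f zero + g zero +_) (sum-+ (f ∘ suc) (g ∘ suc)))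
                          (interchange (f zero) (g zero) _ _)
  where
  interchange : ∀ a b c d → a + b + (c + d) ≡ a + c + (b + d)
  interchange = solve-∀

sum-*ˡ : ∀ {n} c (f : Fin n → ℕ) → sum (λ i → c * f i) ≡ c * sum f
sum-*ˡ {zero}  c f = sym (*-zeroʳ c)
sum-*ˡ {suc n} c f = trans (cong (c * f zero +_) (sum-*ˡ c (f ∘ suc)))
                           (sym (*-distribˡ-+ c (f zero) _))

sum-*ʳ : ∀ {n} c (f : Fin n → ℕ) → sum (λ i → f i * c) ≡ sum f * c
sum-*ʳ c f = trans (sum-cong (λ i → *-comm (f i) c)) (trans (sum-*ˡ c f) (*-comm c _))

sum-const : ∀ n c → sum {n} (λ _ → c) ≡ n * c
sum-const zero    c = refl
sum-const (suc n) c = cong (c +_) (sum-const n c)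

sum-comm : ∀ {m n} (f : Fin m → Fin n → ℕ) →
           sum (λ i → sum (λ j → f i j)) ≡ sum (λ j → sum (λ i → f i j))
sum-comm {zero}  {n} f = sym (trans (sum-const n 0) (*-zeroʳ n))
sum-comm {suc m} {n} f = trans (cong (sum (f zero) +_) (sum-comm (f ∘ suc)))
                               (sym (sum-+ (f zero) _))

sum-mono : ∀ {n} {f g : Fin n → ℕ} → (∀ i → f i ≤ g i) → sum f ≤ sum g
sum-mono {zero}  f≤g = z≤n
sum-mono {suc n} f≤g = +-mono-≤ (f≤g zero) (sum-mono (f≤g ∘ suc))

sum-≤-const : ∀ {n} {f : Fin n → ℕ} {c} → (∀ i → f i ≤ c) → sum f ≤ n * c
sum-≤-const {n} {c = c} f≤c = ≤-trans (sum-mono f≤c) (≤-reflexive (sum-const n c))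

term≤sum : ∀ {n} (f : Fin n → ℕ) i → f i ≤ sum f
term≤sum f zero    = m≤m+n (f zero) _
term≤sum f (suc i) = ≤-trans (term≤sum (f ∘ suc) i) (m≤n+m _ (f zero))

sum₂-mono : ∀ {m n} {f g : Fin m → Fin n → ℕ} → (∀ i j → f i j ≤ g i j) →
            sum (λ i → sum (f i)) ≤ sum (λ i → sum (g i))
sum₂-mono f≤g = sum-mono (λ i → sum-mono (f≤g i))

sum₂-+ : ∀ {m n} (f g : Fin m → Fin n → ℕ) →
         sum (λ i → sum (λ j → f i j + g i j)) ≡ sum (λ i → sum (f i)) + sum (λ i → sum (g i))
sum₂-+ f g = trans (sum-cong (λ i → sum-+ (f i) (g i))) (sum-+ (sum ∘ f) (sum ∘ g))

sum₃ : ∀ {n} → (Fin n → Fin n → Fin n → ℕ) → ℕ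
sum₃ f = sum (λ x → sum (λ y → sum (f x y)))

sum₃-mono : ∀ {n} {f g : Fin n → Fin n → Fin n → ℕ} → (∀ x y z → f x y z ≤ g x y z) → sum₃ f ≤ sum₃ g
sum₃-mono f≤g = sum-mono (λ x → sum₂-mono (f≤g x))

sum₃-+ : ∀ {n} (f g : Fin n → Fin n → Fin n → ℕ) →
         sum₃ (λ x y z → f x y z + g x y z) ≡ sum₃ f + sum₃ g
sum₃-+ f g = trans (sum-cong (λ x → sum₂-+ (f x) (g x))) (sum-+ (λ x → sum (sum ∘ f x)) (λ x → sum (sum ∘ g x)))

-- All six orders of a triple: an edge may then be charged in whichever order fits its type, at the
-- price of a factor 6 in the total.
orbit : ∀ {n} → (Fin n → Fin n → Fin n → ℕ) → Fin n → Fin n → Fin n → ℕ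
orbit f x y z = f x y z + (f y x z + (f y z x + (f z y x + (f z x y + f x z y))))

sum₃-orbit : ∀ {n} (f : Fin n → Fin n → Fin n → ℕ) → sum₃ (orbit f) ≡ 6 * sum₃ f
sum₃-orbit {n} f = begin
  sum₃ (orbit f)                                        ≡⟨ sum₃-+ f _ ⟩
  sum₃ f + sum₃ (λ x y z → f-yxz x y z + (f-yzx x y z + (f-zyx x y z + (f-zxy x y z + f-xzy x y z))))
    ≡⟨ cong (sum₃ f +_) (sum₃-+ f-yxz _) ⟩
  sum₃ f + (sum₃ f-yxz + sum₃ (λ x y z → f-yzx x y z + (f-zyx x y z + (f-zxy x y z + f-xzy x y z))))
    ≡⟨ cong (λ s → sum₃ f + (sum₃ f-yxz + s)) (sum₃-+ f-yzx _) ⟩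
  sum₃ f + (sum₃ f-yxz + (sum₃ f-yzx + sum₃ (λ x y z → f-zyx x y z + (f-zxy x y z + f-xzy x y z))))
    ≡⟨ cong (λ s → sum₃ f + (sum₃ f-yxz + (sum₃ f-yzx + s))) (trans (sum₃-+ f-zyx _) (cong (sum₃ f-zyx +_) (sum₃-+ f-zxy f-xzy))) ⟩
  sum₃ f + (sum₃ f-yxz + (sum₃ f-yzx + (sum₃ f-zyx + (sum₃ f-zxy + sum₃ f-xzy))))
    ≡⟨ cong (sum₃ f +_) (cong₂ _+_ f-yxz≡ (cong₂ _+_ f-yzx≡ (cong₂ _+_ f-zyx≡ (cong₂ _+_ f-zxy≡ f-xzy≡)))) ⟩
  sum₃ f + (sum₃ f + (sum₃ f + (sum₃ f + (sum₃ f + sum₃ f))))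
    ≡⟨ six (sum₃ f) ⟩
  6 * sum₃ f ∎
  where
  open ≡-Reasoning
  f-yxz f-yzx f-zyx f-zxy f-xzy : Fin n → Fin n → Fin n → ℕ
  f-yxz x y z = f y x z
  f-yzx x y z = f y z x
  f-zyx x y z = f z y x
  f-zxy x y z = f z x y
  f-xzy x y z = f x z y
  swap₁ : ∀ g → sum₃ (λ x y z → g y x z) ≡ sum₃ g
  swap₁ g = sum-comm (λ x y → sum (g y x))
  swap₂ : ∀ g → sum₃ (λ x y z → g x z y) ≡ sum₃ g
  swap₂ g = sum-cong (λ x → sum-comm (λ y z → g x z y))
  f-yxz≡ = swap₁ f
  f-xzy≡ = swap₂ f
  f-yzx≡ = trans (swap₁ f-xzy) f-xzy≡
  f-zxy≡ = trans (swap₂ f-yxz) f-yxz≡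
  f-zyx≡ = trans (swap₁ f-zxy) f-zxy≡
  six : ∀ s → s + (s + (s + (s + (s + s)))) ≡ 6 * s
  six = solve-∀

count : ∀ {n} {P : Fin n → Set} → (∀ i → Dec (P i)) → ℕ
count P? = sum (ι ∘ P?)

count-none : ∀ {n} {P : Fin n → Set} (P? : ∀ i → Dec (P i)) → (∀ i → ¬ P i) → count P? ≡ 0
count-none {n} P? ¬P = trans (sum-cong (λ i → ι-no (P? i) (¬P i))) (trans (sum-const n 0) (*-zeroʳ n))

count-unique : ∀ {n} {P : Fin n → Set} (P? : ∀ i → Dec (P i)) →
               (∀ i j → P i → P j → i ≡ j) → count P? ≤ 1
count-unique {zero}  P? uniq = z≤n
count-unique {suc n} P? uniq with P? zero
... | yes p = s≤s (≤-reflexive (count-none (P? ∘ suc) λ i q → case (uniq zero (suc i) p q)))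
  where
  case : ∀ {i : Fin n} → ¬ (zero ≡ suc i)
  case ()
... | no  _ = count-unique (P? ∘ suc) λ i j p q → suc-inj (uniq (suc i) (suc j) p q)
  where
  suc-inj : ∀ {i j : Fin n} → suc i ≡ suc j → i ≡ j
  suc-inj refl = refl

count≤1⇒unique : ∀ {n} {P : Fin n → Set} (P? : ∀ i → Dec (P i)) → count P? ≤ 1 → ∀ {i j} → P i → P j → i ≡ j
count≤1⇒unique P? P≤1 {i} {j} p q = decidable-stable (i ≟ j) λ i≢j → <⇒≱ (two i≢j) P≤1
  where
  open ≤-Reasoning
  two : i ≢ j → 2 ≤ count P?
  two i≢j = begin
    2                                ≤⟨ +-mono-≤ (at i) (at j) ⟩
    count (i ≟_) + count (j ≟_)      ≡⟨ sum-+ (λ x → ι (i ≟ x)) (λ x → ι (j ≟ x)) ⟨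
    sum (λ x → ι (i ≟ x) + ι (j ≟ x)) ≤⟨ sum-mono (λ x → split x (i ≟ x) (j ≟ x)) ⟩
    count P?                         ∎
    where
    at : ∀ i → 1 ≤ count (i ≟_)
    at i = ≤-trans (1≤ι (i ≟ i) refl) (term≤sum (λ x → ι (i ≟ x)) i)
    split : ∀ x (d : Dec (i ≡ x)) (d′ : Dec (j ≡ x)) → ι d + ι d′ ≤ ι (P? x)
    split x (yes refl) (yes refl) = contradiction refl i≢j
    split x (yes refl) (no _)     = 1≤ι (P? x) p
    split x (no _)     (yes refl) = 1≤ι (P? x) q
    split x (no _)     (no _)     = z≤n

module _ {n : ℕ} where

  infix 4 _∈?_

  _∈?_ : (i : Fin n) (L : List (Fin n)) → Dec (i ∈ L)
  _∈?_ = DecMembership._∈?_ _≟_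

  count-∈ : ∀ L → count (_∈? L) ≤ length L
  count-∈ []      = ≤-reflexive (count-none (_∈? []) (λ _ ()))
  count-∈ (x ∷ L) = begin
    count (_∈? (x ∷ L))                       ≤⟨ sum-mono pointwise ⟩
    sum (λ i → ι (i ≟ x) + ι (i ∈? L))        ≡⟨ sum-+ (λ i → ι (i ≟ x)) _ ⟩
    count (_≟ x) + count (_∈? L)              ≤⟨ +-mono-≤ (count-unique (_≟ x) λ { _ _ refl refl → refl }) (count-∈ L) ⟩
    suc (length L)                            ∎
    where
    open ≤-Reasoning
    pointwise : ∀ i → ι (i ∈? (x ∷ L)) ≤ ι (i ≟ x) + ι (i ∈? L)
    pointwise i = ι≤ (i ∈? (x ∷ L)) λ
      { (here p)  → ≤-trans (1≤ι (i ≟ x) p) (m≤m+n _ _)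
      ; (there p) → ≤-trans (1≤ι (i ∈? L) p) (m≤n+m _ _) }

  count-⊆ : ∀ {P : Fin n → Set} (P? : ∀ i → Dec (P i)) L → (∀ i → P i → i ∈ L) → count P? ≤ length L
  count-⊆ P? L P⊆L = ≤-trans (sum-mono (λ i → ι-mono (P? i) (i ∈? L) (P⊆L i))) (count-∈ L)

  pick : ∀ {P : Fin n → Set} (P? : ∀ i → Dec (P i)) L → length L < count P? →
         ∃ λ i → P i × All (i ≢_) L
  pick P? L L<P with any? (λ i → P? i ×-dec ¬? (i ∈? L))
  ... | yes (i , p , i∉L) = i , p , ¬Any⇒All¬ L i∉L
  ... | no  none = contradiction L<P (≤⇒≯ (count-⊆ P? L λ i p → decidable-stable (i ∈? L) λ i∉L → none (i , p , i∉L)))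

  module _ {R : Fin n → Fin n → Set} (R? : ∀ i j → Dec (R i j)) (r : ℕ)
           (rows : ∀ i → count (R? i) ≤ r) (cols : ∀ j → count (λ i → R? i j) ≤ r) where

    -- Each vertex of `L` accounts for one row and one column, so for at most `2 * r` pairs.
    cover-bound : ∀ L → (∀ i j → R i j → i ∈ L ⊎ j ∈ L) →
                  sum (λ i → count (R? i)) ≤ (length L + length L) * r
    cover-bound L cov = begin
      sum (λ i → count (R? i))
        ≤⟨ sum₂-mono pointwise ⟩
      sum (λ i → sum (λ j → ι (i ∈? L) * ι (R? i j) + ι (j ∈? L) * ι (R? i j)))
        ≡⟨ sum₂-+ (λ i j → ι (i ∈? L) * ι (R? i j)) _ ⟩
      sum (λ i → sum (λ j → ι (i ∈? L) * ι (R? i j))) + sum (λ i → sum (λ j → ι (j ∈? L) * ι (R? i j)))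
        ≡⟨ cong (sum (λ i → sum (λ j → ι (i ∈? L) * ι (R? i j))) +_) (sum-comm (λ i j → ι (j ∈? L) * ι (R? i j))) ⟩
      sum (λ i → sum (λ j → ι (i ∈? L) * ι (R? i j))) + sum (λ j → sum (λ i → ι (j ∈? L) * ι (R? i j)))
        ≤⟨ +-mono-≤ (half R? rows) (half (flip R?) cols) ⟩
      length L * r + length L * r
        ≡⟨ *-distribʳ-+ r (length L) (length L) ⟨
      (length L + length L) * r ∎
      where
      open ≤-Reasoning
      pointwise : ∀ i j → ι (R? i j) ≤ ι (i ∈? L) * ι (R? i j) + ι (j ∈? L) * ι (R? i j)
      pointwise i j = ι≤ (R? i j) λ p → case p (cov i j p)
        where
        case : R i j → i ∈ L ⊎ j ∈ L → 1 ≤ ι (i ∈? L) * ι (R? i j) + ι (j ∈? L) * ι (R? i j)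
        case p (inj₁ m) = ≤-trans (*-mono-≤ (1≤ι (i ∈? L) m) (1≤ι (R? i j) p)) (m≤m+n _ _)
        case p (inj₂ m) = ≤-trans (*-mono-≤ (1≤ι (j ∈? L) m) (1≤ι (R? i j) p)) (m≤n+m _ _)
      half : ∀ {Q : Fin n → Fin n → Set} (Q? : ∀ i j → Dec (Q i j)) → (∀ i → count (Q? i) ≤ r) →
             sum (λ i → sum (λ j → ι (i ∈? L) * ι (Q? i j))) ≤ length L * r
      half Q? row = begin
        sum (λ i → sum (λ j → ι (i ∈? L) * ι (Q? i j)))  ≡⟨ sum-cong (λ i → sum-*ˡ (ι (i ∈? L)) (ι ∘ Q? i)) ⟩
        sum (λ i → ι (i ∈? L) * count (Q? i))            ≤⟨ sum-mono (λ i → *-monoʳ-≤ (ι (i ∈? L)) (row i)) ⟩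
        sum (λ i → ι (i ∈? L) * r)                       ≡⟨ sum-*ʳ r (λ i → ι (i ∈? L)) ⟩
        count (_∈? L) * r                                ≤⟨ *-monoˡ-≤ r (count-∈ L) ⟩
        length L * r                                     ∎

    -- The cover may be built from any one related pair; without such a pair there is nothing to
    -- count.
    covered-bound : ∀ ℓ → (∀ i j → R i j → ∃ λ L → length L ≡ ℓ × (∀ i j → R i j → i ∈ L ⊎ j ∈ L)) →
                    sum (λ i → count (R? i)) ≤ (ℓ + ℓ) * r
    covered-bound ℓ cov with any? (λ i → any? (R? i))
    ... | yes (i , j , p) with cov i j p
    ...   | L , refl , c = cover-bound L c
    covered-bound ℓ cov | no none = ≤-trans (≤-reflexive zeros) z≤n
      where
      zeros : sum (λ i → count (R? i)) ≡ 0
      zeros = trans (sum-cong (λ i → count-none (R? i) (λ j p → none (i , j , p))))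
                    (trans (sum-const n 0) (*-zeroʳ n))

    -- Otherwise `L` would be a cover and there would be too few pairs. This supplies the outer
    -- edges of loose paths, away from vertices already used.
    pick₂ : ∀ L → (length L + length L) * r < sum (λ i → count (R? i)) →
            ∃₂ λ i j → R i j × All (i ≢_) L × All (j ≢_) L
    pick₂ L big with any? (λ i → any? (λ j → R? i j ×-dec (¬? (i ∈? L) ×-dec ¬? (j ∈? L))))
    ... | yes (i , j , p , i∉L , j∉L) = i , j , p , ¬Any⇒All¬ L i∉L , ¬Any⇒All¬ L j∉L
    ... | no  none = contradiction big (≤⇒≯ (cover-bound L cov))
      where
      cov : ∀ i j → R i j → i ∈ L ⊎ j ∈ L
      cov i j p with i ∈? L | j ∈? L
      ... | yes m | _     = inj₁ m
      ... | no  _ | yes m = inj₂ m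
      ... | no  a | no  b = contradiction (i , j , p , a , b) none

-- Edges of a colour class without a loose path

module _ {n : ℕ} where

  NoOut : (Fin n → Fin n → Set) → Fin n → Set
  NoOut O x = ∀ y → ¬ O x y

  -- First the star edges with centre x, y or z, then the pages x, y or z of a book whose spine is
  -- the other two vertices.
  Structured : (Fin n → Fin n → Set) → Fin n → Fin n → Fin n → Set
  Structured O x y z =
    (O y x × O z x) ⊎ (O x y × O z y) ⊎ (O x z × O y z) ⊎
    (O y z × O z y × NoOut O x) ⊎ (O x z × O z x × NoOut O y) ⊎ (O x y × O y x × NoOut O z)

pattern sink₁ p q = inj₁ (p , q)
pattern sink₂ p q = inj₂ (inj₁ (p , q))
pattern sink₃ p q = inj₂ (inj₂ (inj₁ (p , q)))
pattern page₁ p q r = inj₂ (inj₂ (inj₂ (inj₁ (p , q , r))))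
pattern page₂ p q r = inj₂ (inj₂ (inj₂ (inj₂ (inj₁ (p , q , r)))))
pattern page₃ p q r = inj₂ (inj₂ (inj₂ (inj₂ (inj₂ (p , q , r)))))

module _ {n : ℕ} {O : Fin n → Fin n → Set} where

  noOut? : (∀ x y → Dec (O x y)) → ∀ x → Dec (NoOut O x)
  noOut? O? x = all? (λ y → ¬? (O? x y))

  structured? : (∀ x y → Dec (O x y)) → ∀ x y z → Dec (Structured O x y z)
  structured? O? x y z =
    (O? y x ×-dec O? z x) ⊎-dec ((O? x y ×-dec O? z y) ⊎-dec ((O? x z ×-dec O? y z) ⊎-dec
    ((O? y z ×-dec (O? z y ×-dec noOut? O? x)) ⊎-dec ((O? x z ×-dec (O? z x ×-dec noOut? O? y)) ⊎-dec
    (O? x y ×-dec (O? y x ×-dec noOut? O? z))))))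

  rotate : ∀ {x y z} → Structured O x y z → Structured O y z x
  rotate (sink₁ p q)   = sink₃ p q
  rotate (sink₂ p q)   = sink₁ q p
  rotate (sink₃ p q)   = sink₂ q p
  rotate (page₁ p q r) = page₃ p q r
  rotate (page₂ p q r) = page₁ q p r
  rotate (page₃ p q r) = page₂ q p r

-- Only vertices without a common edge of the path are required to differ; those of a common edge of
-- a colour class are distinct anyway.
LooseFree : ∀ {n} → (Fin n → Fin n → Fin n → Set) → Set
LooseFree H = ∀ {a b c d e f g} → H a b c → H c d e → H e f g →
  All (a ≢_) (d ∷ e ∷ f ∷ g ∷ []) → All (b ≢_) (d ∷ e ∷ f ∷ g ∷ []) →
  All (c ≢_) (f ∷ g ∷ []) → All (d ≢_) (f ∷ g ∷ []) → ⊥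

module ColourClass {n : ℕ} (H : Fin n → Fin n → Fin n → Set) (H? : ∀ x y z → Dec (H x y z))
  (swap : ∀ {x y z} → H x y z → H y x z) (turn : ∀ {x y z} → H x y z → H y z x)
  (irr : ∀ {x y z} → H x y z → x ≢ y) (loose-free : LooseFree H)
  (C : ℕ) (5≤C : 5 ≤ C) where

  private
    V = Fin n

  swap₂₃ : ∀ {x y z} → H x y z → H x z y
  swap₂₃ = swap ∘ turn ∘ turn

  irr₂₃ : ∀ {x y z} → H x y z → y ≢ z
  irr₂₃ = irr ∘ turn

  irr₁₃ : ∀ {x y z} → H x y z → x ≢ z
  irr₁₃ h = ≢-sym (irr (turn (turn h)))

  codegree : V → V → ℕ
  codegree x y = count (H? x y)

  Heavy : V → V → Set
  Heavy x y = C ≤ codegree x y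

  heavy? : ∀ x y → Dec (Heavy x y)
  heavy? x y = C ≤? codegree x y

  heavy-sym : ∀ {x y} → Heavy x y → Heavy y x
  heavy-sym {x} {y} = subst (C ≤_) (sum-cong (λ z → ι-cong (H? x y z) (H? y x z) swap swap))

  -- The threshold 5 leaves room to avoid four vertices, the worst case when a loose path is built
  -- greedily.
  third : ∀ {x y} → Heavy x y → ∀ L → length L < 5 → ∃ λ z → H x y z × All (z ≢_) L
  third {x} {y} h L L<5 = pick (H? x y) L (≤-trans L<5 (≤-trans 5≤C h))

  heavy-irr : ∀ {x y} → Heavy x y → x ≢ y
  heavy-irr h = irr (proj₁ (proj₂ (third h [] (s≤s z≤n))))

  -- Completing the three pairs by distinct third vertices `a`, `b`, `c` gives the loose path axy,
  -- ybz, zcw.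
  no-heavy-path : ∀ {x y z w} → Heavy x y → Heavy y z → Heavy z w → x ≢ z → y ≢ w → x ≢ w → ⊥
  no-heavy-path {x} {y} {z} {w} xy yz zw x≢z y≢w x≢w
    with third xy (z ∷ w ∷ []) (m≤m+n 3 2)
  ... | a , xya , a≢z ∷ a≢w ∷ [] with third yz (x ∷ w ∷ a ∷ []) (m≤m+n 4 1)
  ... | b , yzb , b≢x ∷ b≢w ∷ b≢a ∷ [] with third zw (x ∷ y ∷ a ∷ b ∷ []) (m≤m+n 5 0)
  ... | c , zwc , c≢x ∷ c≢y ∷ c≢a ∷ c≢b ∷ [] =
    loose-free (turn (turn xya)) (swap₂₃ yzb) (swap₂₃ zwc)
      (≢-sym b≢a ∷ a≢z ∷ ≢-sym c≢a ∷ a≢w ∷ [])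
      (≢-sym b≢x ∷ x≢z ∷ ≢-sym c≢x ∷ x≢w ∷ [])
      (≢-sym c≢y ∷ y≢w ∷ []) (≢-sym c≢b ∷ b≢w ∷ [])

  O : V → V → Set
  O x y = Heavy x y × (∀ y′ → Heavy x y′ → y′ ≡ y)

  O? : ∀ x y → Dec (O x y)
  O? x y = heavy? x y ×-dec only?
    where
    only? : Dec (∀ y′ → Heavy x y′ → y′ ≡ y)
    only? with any? (λ y′ → heavy? x y′ ×-dec ¬? (y′ ≟ y))
    ... | yes (y′ , h , y′≢y) = no λ only → y′≢y (only y′ h)
    ... | no  none            = yes λ y′ h → decidable-stable (y′ ≟ y) λ y′≢y → none (y′ , h , y′≢y)

  O-functional : ∀ {x y y′} → O x y → O x y′ → y ≡ y′
  O-functional (h , _) (_ , only) = only _ h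

  O-irr : ∀ {x y} → O x y → x ≢ y
  O-irr (h , _) = heavy-irr h

  second-neighbour : ∀ {x y} → Heavy x y → ¬ O x y → ∃ λ x₁ → Heavy x x₁ × x₁ ≢ y
  second-neighbour {x} {y} h ¬o with any? (λ y′ → heavy? x y′ ×-dec ¬? (y′ ≟ y))
  ... | yes found = found
  ... | no  none  = contradiction
    (h , λ y′ h′ → decidable-stable (y′ ≟ y) λ y′≢y → none (y′ , h′ , y′≢y)) ¬o

  -- Four kinds of edges that need not be structured

  Light Triangle Multi Foreign : V → V → V → Set
  Light    x y z = H x y z × ¬ Heavy x y × ¬ Heavy x z × ¬ Heavy y z
  Triangle x y z = Heavy x y × Heavy x z × Heavy y z
  Multi    x y z = H x y z × ¬ Heavy x z × ¬ Heavy y z × ∃ λ x₁ → Heavy x x₁ × x₁ ≢ y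
  Foreign  x y z = H x y z × O x y × O y x × ∃ λ z′ → Heavy z z′

  light? : ∀ x y z → Dec (Light x y z)
  light? x y z = H? x y z ×-dec (¬? (heavy? x y) ×-dec (¬? (heavy? x z) ×-dec ¬? (heavy? y z)))

  triangle? : ∀ x y z → Dec (Triangle x y z)
  triangle? x y z = heavy? x y ×-dec (heavy? x z ×-dec heavy? y z)

  multi? : ∀ x y z → Dec (Multi x y z)
  multi? x y z = H? x y z ×-dec (¬? (heavy? x z) ×-dec (¬? (heavy? y z) ×-dec
    any? (λ x₁ → heavy? x x₁ ×-dec ¬? (x₁ ≟ y))))

  foreign? : ∀ x y z → Dec (Foreign x y z)
  foreign? x y z = H? x y z ×-dec (O? x y ×-dec (O? y x ×-dec any? (heavy? z)))

  module _ {R : V → V → V → Set} (R? : ∀ x y z → Dec (R x y z))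
           (edge : ∀ {x y z} → R x y z → H x y z)
           (¬heavy₁ : ∀ {x y z} → R x y z → ¬ Heavy x z)
           (¬heavy₂ : ∀ {x y z} → R x y z → ¬ Heavy y z) where

    -- A pair xz that is not heavy has fewer than `C` completions y.
    light-row : ∀ z x → count (λ y → R? x y z) ≤ C
    light-row z x with heavy? x z
    ... | yes h = ≤-trans (≤-reflexive (count-none (λ y → R? x y z) (λ y r → ¬heavy₁ r h))) z≤n
    ... | no ¬h = ≤-trans (sum-mono (λ y → ι-mono (R? x y z) (H? x z y) (swap₂₃ ∘ edge)))
                          (<⇒≤ (≰⇒> ¬h))

    light-col : ∀ z y → count (λ x → R? x y z) ≤ C
    light-col z y with heavy? y z
    ... | yes h = ≤-trans (≤-reflexive (count-none (λ x → R? x y z) (λ x r → ¬heavy₂ r h))) z≤n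
    ... | no ¬h = ≤-trans (sum-mono (λ x → ι-mono (R? x y z) (H? y z x) (turn ∘ edge)))
                          (<⇒≤ (≰⇒> ¬h))

  light-degree foreign-degree : V → ℕ
  light-degree   z = sum (λ x → count (λ y → light? x y z))
  foreign-degree z = sum (λ x → count (λ y → foreign? x y z))

  pick-light : ∀ {z} → 8 * C < light-degree z → ∀ L → length L ≤ 4 →
               ∃₂ λ x y → Light x y z × All (x ≢_) L × All (y ≢_) L
  pick-light {z} big L L≤4 = pick₂ (λ x y → light? x y z) C
    (light-row light? proj₁ (proj₁ ∘ proj₂ ∘ proj₂) (proj₂ ∘ proj₂ ∘ proj₂) z)
    (light-col light? proj₁ (proj₁ ∘ proj₂ ∘ proj₂) (proj₂ ∘ proj₂ ∘ proj₂) z)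
    L (≤-<-trans (*-monoˡ-≤ C (+-mono-≤ L≤4 L≤4)) big)

  -- Light edges abz and fgx, chosen disjoint from each other and from the rest of xyz, would extend
  -- xyz at both ends to a loose path. So every light edge can be charged to a vertex of small light
  -- degree.
  no-two-big : ∀ {x y z} → H x y z → 8 * C < light-degree x → 8 * C < light-degree z → ⊥
  no-two-big {x} {y} {z} hxyz bx bz with pick-light bz (y ∷ x ∷ []) (m≤m+n 2 2)
  ... | a , b , (abz , _) , a≢y ∷ a≢x ∷ [] , b≢y ∷ b≢x ∷ []
    with pick-light bx (z ∷ y ∷ a ∷ b ∷ []) ≤-refl
  ... | f , g , (fgx , _) , f≢z ∷ f≢y ∷ f≢a ∷ f≢b ∷ [] , g≢z ∷ g≢y ∷ g≢a ∷ g≢b ∷ [] =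
    loose-free abz (swap (swap₂₃ (swap hxyz))) (turn (turn fgx))
      (a≢y ∷ a≢x ∷ ≢-sym f≢a ∷ ≢-sym g≢a ∷ [])
      (b≢y ∷ b≢x ∷ ≢-sym f≢b ∷ ≢-sym g≢b ∷ [])
      (≢-sym f≢z ∷ ≢-sym g≢z ∷ []) (≢-sym f≢y ∷ ≢-sym g≢y ∷ [])

  -- Two entries in a row would give the heavy path y, x, z, y₁, and similarly for columns. A
  -- triangle x′y′z with x′ outside {x, y} would give the heavy path x′, z, x, y.
  triangle-count : ∀ z → sum (λ x → count (λ y → triangle? x y z)) ≤ 4
  triangle-count z = covered-bound (λ x y → triangle? x y z) 1 row col 2 cover
    where
    row : ∀ x → count (λ y → triangle? x y z) ≤ 1
    row x = count-unique (λ y → triangle? x y z) λ y y₁ (xy , xz , yz) (xy₁ , _ , y₁z) → decidable-stable (y ≟ y₁)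
      λ y≢y₁ → no-heavy-path (heavy-sym xy) xz (heavy-sym y₁z) (heavy-irr yz) (heavy-irr xy₁) y≢y₁
    col : ∀ y → count (λ x → triangle? x y z) ≤ 1
    col y = count-unique (λ x → triangle? x y z) λ x x₁ (xy , xz , yz) (x₁y , x₁z , _) → decidable-stable (x ≟ x₁)
      λ x≢x₁ → no-heavy-path xy yz (heavy-sym x₁z) (heavy-irr xz) (≢-sym (heavy-irr x₁y)) x≢x₁
    cover : ∀ x y → Triangle x y z →
            ∃ λ L → length L ≡ 2 × (∀ x′ y′ → Triangle x′ y′ z → x′ ∈ L ⊎ y′ ∈ L)
    cover x y (xy , xz , yz) = x ∷ y ∷ [] , refl , hit
      where
      hit : ∀ x′ y′ → Triangle x′ y′ z → x′ ∈ x ∷ y ∷ [] ⊎ y′ ∈ x ∷ y ∷ []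
      hit x′ y′ (_ , x′z , _) with x′ ≟ x | x′ ≟ y
      ... | yes p | _     = inj₁ (here p)
      ... | no  _ | yes p = inj₁ (there (here p))
      ... | no x′≢x | no x′≢y =
        ⊥-elim (no-heavy-path x′z (heavy-sym xz) xy x′≢x (≢-sym (heavy-irr yz)) x′≢y)

  -- Let `a` complete the heavy pair xx₁. If x′ and y′ avoid x, y and x₁, then ax₁x, xyz, zx′y′ is a
  -- loose path; so these three vertices cover all pairs.
  multi-count : ∀ z → sum (λ x → count (λ y → multi? x y z)) ≤ 6 * C
  multi-count z = covered-bound (λ x y → multi? x y z) C
    (light-row multi? proj₁ (proj₁ ∘ proj₂) (proj₁ ∘ proj₂ ∘ proj₂) z)
    (light-col multi? proj₁ (proj₁ ∘ proj₂) (proj₁ ∘ proj₂ ∘ proj₂) z) 3 cover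
    where
    cover : ∀ x y → Multi x y z →
            ∃ λ L → length L ≡ 3 × (∀ x′ y′ → Multi x′ y′ z → x′ ∈ L ⊎ y′ ∈ L)
    cover x y (hxyz , ¬xz , _ , x₁ , xx₁ , x₁≢y) = L , refl , hit
      where
      L = x ∷ y ∷ x₁ ∷ []
      hit : ∀ x′ y′ → Multi x′ y′ z → x′ ∈ L ⊎ y′ ∈ L
      hit x′ y′ (x′y′z , _) with x′ ∈? L | y′ ∈? L
      ... | yes p | _     = inj₁ p
      ... | no  _ | yes p = inj₂ p
      ... | no x′∉L | no y′∉L with third xx₁ (y ∷ z ∷ x′ ∷ y′ ∷ []) ≤-refl
      ... | a , xx₁a , a≢y ∷ a≢z ∷ a≢x′ ∷ a≢y′ ∷ [] =
        ⊥-elim (loose-free (turn (turn (swap xx₁a))) hxyz (turn (turn x′y′z))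
          (a≢y ∷ a≢z ∷ a≢x′ ∷ a≢y′ ∷ [])
          (x₁≢y ∷ (λ { refl → ¬xz xx₁ }) ∷
            (λ { refl → x′∉L (there (there (here refl))) }) ∷
            (λ { refl → y′∉L (there (there (here refl))) }) ∷ [])
          ((λ { refl → x′∉L (here refl) }) ∷ (λ { refl → y′∉L (here refl) }) ∷ [])
          ((λ { refl → x′∉L (there (here refl)) }) ∷ (λ { refl → y′∉L (there (here refl)) }) ∷ []))

  foreign-row : ∀ z x → count (λ y → foreign? x y z) ≤ 1
  foreign-row z x = count-unique (λ y → foreign? x y z) λ y y₁ (_ , o , _) (_ , o₁ , _) → O-functional o o₁

  foreign-col : ∀ z y → count (λ x → foreign? x y z) ≤ 1
  foreign-col z y = count-unique (λ x → foreign? x y z) λ x x₁ (_ , _ , o , _) (_ , _ , o₁ , _) → O-functional o o₁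

  -- The pages of distinct busy components are disjoint, so busy vertices are rare; the
  -- other vertices lie on at most 8 foreign edges.
  Busy : V → Set
  Busy z = 8 < foreign-degree z

  busy? : ∀ z → Dec (Busy z)
  busy? z = 8 <? foreign-degree z

  pick-foreign : ∀ {z} → Busy z → ∀ L → length L ≤ 4 →
                 ∃₂ λ x y → Foreign x y z × All (x ≢_) L × All (y ≢_) L
  pick-foreign {z} busy L L≤4 = pick₂ (λ x y → foreign? x y z) 1 (foreign-row z) (foreign-col z)
    L (≤-<-trans (*-monoˡ-≤ 1 (+-mono-≤ L≤4 L≤4)) busy)

  -- A foreign edge at z, an edge on zz′ and an edge on z′w would form a loose path. So a heavy
  -- neighbour of a busy vertex has no further heavy neighbour.
  busy-not-leaf : ∀ {z z′ w} → Busy z → Heavy z z′ → Heavy z′ w → w ≢ z → ⊥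
  busy-not-leaf {z} {z′} {w} bz zz′ z′w w≢z with pick-foreign bz (z′ ∷ w ∷ []) (m≤m+n 2 2)
  ... | x , y , (hxyz , _) , x≢z′ ∷ x≢w ∷ [] , y≢z′ ∷ y≢w ∷ []
    with third zz′ (x ∷ y ∷ w ∷ []) (m≤m+n 4 1)
  ... | b , zz′b , b≢x ∷ b≢y ∷ b≢w ∷ [] with third z′w (x ∷ y ∷ z ∷ b ∷ []) ≤-refl
  ... | c , z′wc , c≢x ∷ c≢y ∷ c≢z ∷ c≢b ∷ [] =
    loose-free hxyz (swap₂₃ zz′b) (swap₂₃ z′wc)
      (≢-sym b≢x ∷ x≢z′ ∷ ≢-sym c≢x ∷ x≢w ∷ [])
      (≢-sym b≢y ∷ y≢z′ ∷ ≢-sym c≢y ∷ y≢w ∷ [])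
      (≢-sym c≢z ∷ ≢-sym w≢z ∷ []) (≢-sym c≢b ∷ b≢w ∷ [])

  -- A foreign edge xyz avoiding the other four vertices would continue through zz′a to aww′.
  busy-pages-disjoint : ∀ {z z′ w w′ a} → Busy z → H z z′ a → H w w′ a →
                        All (z ≢_) (w ∷ w′ ∷ []) → All (z′ ≢_) (w ∷ w′ ∷ []) → ⊥
  busy-pages-disjoint {z} {z′} {w} {w′} {a} bz zz′a ww′a z∉ z′∉
    with pick-foreign bz (z′ ∷ a ∷ w ∷ w′ ∷ []) ≤-refl
  ... | x , y , (hxyz , _) , x∉ , y∉ = loose-free hxyz zz′a (turn (turn ww′a)) x∉ y∉ z∉ z′∉

  BusyPage : V → V → Set
  BusyPage z a = Busy z × ∃ λ z′ → Heavy z z′ × H z z′ a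

  busyPage? : ∀ z a → Dec (BusyPage z a)
  busyPage? z a = busy? z ×-dec any? (λ z′ → heavy? z z′ ×-dec H? z z′ a)

  busy-pages : ∀ z → ι (busy? z) * C ≤ count (busyPage? z)
  busy-pages z = ι*≤ (busy? z) enough
    where
    enough : Busy z → C ≤ count (busyPage? z)
    enough bz with pick-foreign bz [] z≤n
    ... | x , y , (_ , _ , _ , z′ , zz′) , _ =
      ≤-trans zz′ (sum-mono (λ a → ι-mono (H? z z′ a) (busyPage? z a) λ h → bz , z′ , zz′ , h))

  -- Fix one busy page with heavy pair ww′. Another heavy pair zz′ cannot be disjoint from it, by
  -- `busy-pages-disjoint`, nor meet it in z′ alone, by `busy-not-leaf`.
  busy-at-page : ∀ a → count (λ z → busyPage? z a) ≤ 2
  busy-at-page a with any? (λ z → busyPage? z a)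
  ... | no none = ≤-trans (≤-reflexive (count-none (λ z → busyPage? z a) (λ z p → none (z , p)))) z≤n
  ... | yes (w , bw , w′ , ww′ , ww′a) = count-⊆ (λ z → busyPage? z a) (w ∷ w′ ∷ []) hit
    where
    hit : ∀ z → BusyPage z a → z ∈ w ∷ w′ ∷ []
    hit z (bz , z′ , zz′ , zz′a) with z ≟ w | z ≟ w′
    ... | yes p | _     = here p
    ... | no  _ | yes p = there (here p)
    ... | no z≢w | no z≢w′ = ⊥-elim (busy-pages-disjoint bz zz′a ww′a (z≢w ∷ z≢w′ ∷ [])
      ( (λ { refl → busy-not-leaf bz zz′ ww′ (≢-sym z≢w′) })
      ∷ (λ { refl → busy-not-leaf bz zz′ (heavy-sym ww′) (≢-sym z≢w) }) ∷ []))

  busy-count : C * count busy? ≤ 2 * n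
  busy-count = begin
    C * count busy?                         ≡⟨ sum-*ˡ C (ι ∘ busy?) ⟨
    sum (λ z → C * ι (busy? z))             ≤⟨ sum-mono (λ z → ≤-trans (≤-reflexive (*-comm C (ι (busy? z)))) (busy-pages z)) ⟩
    sum (λ z → count (busyPage? z))         ≡⟨ sum-comm (λ z a → ι (busyPage? z a)) ⟩
    sum (λ a → count (λ z → busyPage? z a)) ≤⟨ sum-≤-const busy-at-page ⟩
    n * 2                                   ≡⟨ *-comm n 2 ⟩
    2 * n                                   ∎
    where open ≤-Reasoning

  -- Counting the exceptional edges of one colour

  SmallLight : V → V → V → Set
  SmallLight x y z = Light x y z × light-degree z ≤ 8 * C

  smallLight? : ∀ x y z → Dec (SmallLight x y z)
  smallLight? x y z = light? x y z ×-dec (light-degree z ≤? 8 * C)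

  Exceptional : V → V → V → Set
  Exceptional x y z = H x y z × ¬ Structured O x y z

  exceptional? : ∀ x y z → Dec (Exceptional x y z)
  exceptional? x y z = H? x y z ×-dec ¬? (structured? O? x y z)

  weight : V → V → V → ℕ
  weight x y z = ι (smallLight? x y z) + (ι (triangle? x y z) + (ι (multi? x y z) + ι (foreign? x y z)))

  light-count : ∀ z → sum (λ x → count (λ y → smallLight? x y z)) ≤ 8 * C
  light-count z = split (light-degree z ≤? 8 * C)
    where
    split : Dec (light-degree z ≤ 8 * C) → sum (λ x → count (λ y → smallLight? x y z)) ≤ 8 * C
    split (yes small) = ≤-trans (sum₂-mono λ x y → ι-mono (smallLight? x y z) (light? x y z) proj₁) small
    split (no  big)   = ≤-trans (≤-reflexive zeros) z≤n
      where
      zeros : sum (λ x → count (λ y → smallLight? x y z)) ≡ 0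
      zeros = trans (sum-cong (λ x → count-none (λ y → smallLight? x y z) (λ y p → big (proj₂ p)))) (trans (sum-const n 0) (*-zeroʳ n))

  -- A busy vertex is charged the trivial bound `n`, affordable because busy vertices are few.
  foreign-count : ∀ z → foreign-degree z ≤ 8 + ι (busy? z) * n
  foreign-count z = split (busy? z)
    where
    split : Dec (Busy z) → foreign-degree z ≤ 8 + ι (busy? z) * n
    split (no ¬b) = m≤n⇒m≤n+o _ (≮⇒≥ ¬b)
    split (yes b) = begin
      foreign-degree z     ≤⟨ sum-≤-const (foreign-row z) ⟩
      n * 1                ≡⟨ *-comm n 1 ⟩
      1 * n                ≤⟨ *-monoˡ-≤ n (1≤ι (busy? z) b) ⟩
      ι (busy? z) * n      ≤⟨ m≤n+m _ 8 ⟩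
      8 + ι (busy? z) * n  ∎
      where open ≤-Reasoning

  weight-at : ∀ z → sum (λ x → sum (λ y → weight x y z)) ≤ 14 * C + 12 + ι (busy? z) * n
  weight-at z = begin
    sum (λ x → sum (λ y → weight x y z))
      ≡⟨ sum₂-+ (λ x y → ι (smallLight? x y z)) _ ⟩
    sl + sum (λ x → sum (λ y → ι (triangle? x y z) + (ι (multi? x y z) + ι (foreign? x y z))))
      ≡⟨ cong (sl +_) (sum₂-+ (λ x y → ι (triangle? x y z)) _) ⟩
    sl + (tr + sum (λ x → sum (λ y → ι (multi? x y z) + ι (foreign? x y z))))
      ≡⟨ cong (λ s → sl + (tr + s)) (sum₂-+ (λ x y → ι (multi? x y z)) _) ⟩
    sl + (tr + (mu + foreign-degree z))
      ≤⟨ +-mono-≤ (light-count z) (+-mono-≤ (triangle-count z) (+-mono-≤ (multi-count z) (foreign-count z))) ⟩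
    8 * C + (4 + (6 * C + (8 + ι (busy? z) * n)))
      ≡⟨ collect C (ι (busy? z) * n) ⟩
    14 * C + 12 + ι (busy? z) * n ∎
    where
    open ≤-Reasoning
    sl = sum (λ x → count (λ y → smallLight? x y z))
    tr = sum (λ x → count (λ y → triangle? x y z))
    mu = sum (λ x → count (λ y → multi? x y z))
    collect : ∀ C b → 8 * C + (4 + (6 * C + (8 + b))) ≡ 14 * C + 12 + b
    collect = solve-∀

  pattern π₁ p = inj₁ p
  pattern π₂ p = inj₂ (inj₁ p)
  pattern π₃ p = inj₂ (inj₂ (inj₁ p))
  pattern π₄ p = inj₂ (inj₂ (inj₂ (inj₁ p)))
  pattern π₅ p = inj₂ (inj₂ (inj₂ (inj₂ (inj₁ p))))
  pattern π₆ p = inj₂ (inj₂ (inj₂ (inj₂ (inj₂ p))))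

  Kind : V → V → V → Set
  Kind x y z = SmallLight x y z ⊎ Triangle x y z ⊎ Multi x y z ⊎ Foreign x y z

  Kind₆ : V → V → V → Set
  Kind₆ x y z = Kind x y z ⊎ Kind y x z ⊎ Kind y z x ⊎ Kind z y x ⊎ Kind z x y ⊎ Kind x z y

  kind⇒weight : ∀ {x y z} → Kind x y z → 1 ≤ weight x y z
  kind⇒weight {x} {y} {z} (inj₁ p) = m≤n⇒m≤n+o _ (1≤ι (smallLight? x y z) p)
  kind⇒weight {x} {y} {z} (inj₂ (inj₁ p)) =
    m≤n⇒m≤o+n (ι (smallLight? x y z)) (m≤n⇒m≤n+o _ (1≤ι (triangle? x y z) p))
  kind⇒weight {x} {y} {z} (inj₂ (inj₂ (inj₁ p))) =
    m≤n⇒m≤o+n (ι (smallLight? x y z)) (m≤n⇒m≤o+n (ι (triangle? x y z))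
      (m≤n⇒m≤n+o _ (1≤ι (multi? x y z) p)))
  kind⇒weight {x} {y} {z} (inj₂ (inj₂ (inj₂ p))) =
    m≤n⇒m≤o+n (ι (smallLight? x y z)) (m≤n⇒m≤o+n (ι (triangle? x y z))
      (m≤n⇒m≤o+n (ι (multi? x y z)) (1≤ι (foreign? x y z) p)))

  kind₆⇒orbit : ∀ {x y z} → Kind₆ x y z → 1 ≤ orbit weight x y z
  kind₆⇒orbit {x} {y} {z} = λ
    { (π₁ p) → here′ p
    ; (π₂ p) → skip x y z (here′ p)
    ; (π₃ p) → skip x y z (skip y x z (here′ p))
    ; (π₄ p) → skip x y z (skip y x z (skip y z x (here′ p)))
    ; (π₅ p) → skip x y z (skip y x z (skip y z x (skip z y x (here′ p))))
    ; (π₆ p) → skip x y z (skip y x z (skip y z x (skip z y x (skip z x y (kind⇒weight p))))) }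
    where
    here′ : ∀ {x y z r} → Kind x y z → 1 ≤ weight x y z + r
    here′ p = m≤n⇒m≤n+o _ (kind⇒weight p)
    skip : ∀ x y z {r} → 1 ≤ r → 1 ≤ weight x y z + r
    skip x y z = m≤n⇒m≤o+n (weight x y z)

  -- Another heavy neighbour x′ of x would give the heavy path x′, x, z, y.
  two-heavy : ∀ {x y z} → Heavy x z → Heavy y z → ¬ Heavy x y → x ≢ y → O x z × O y z
  two-heavy {x} {y} {z} xz yz ¬xy x≢y =
    (xz , only xz yz ¬xy x≢y) , (yz , only yz xz (¬xy ∘ heavy-sym) (≢-sym x≢y))
    where
    only : ∀ {x y} → Heavy x z → Heavy y z → ¬ Heavy x y → x ≢ y → ∀ x′ → Heavy x x′ → x′ ≡ z
    only {x} {y} xz yz ¬xy x≢y x′ xx′ = decidable-stable (x′ ≟ z) λ x′≢z →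
      no-heavy-path (heavy-sym xx′) xz (heavy-sym yz) x′≢z x≢y (λ { refl → ¬xy xx′ })

  one-heavy : ∀ {x y z} → H x y z → Heavy x y → ¬ Heavy x z → ¬ Heavy y z →
              Structured O x y z ⊎ Kind x y z ⊎ Kind y x z
  one-heavy {x} {y} {z} h xy ¬xz ¬yz with O? x y
  ... | no ¬o = inj₂ (inj₁ (inj₂ (inj₂ (inj₁ (h , ¬xz , ¬yz , second-neighbour xy ¬o)))))
  ... | yes o with O? y x
  ... | no ¬o′ = inj₂ (inj₂ (inj₂ (inj₂ (inj₁ (swap h , ¬yz , ¬xz , second-neighbour (heavy-sym xy) ¬o′)))))
  ... | yes o′ with any? (heavy? z)
  ... | yes found = inj₂ (inj₁ (inj₂ (inj₂ (inj₂ (h , o , o′ , found)))))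
  ... | no  none  = inj₁ (page₃ o o′ λ z′ zz′ → none (z′ , proj₁ zz′))

  -- By the number of heavy pairs in the edge: three make a triangle, two a star edge, one is left
  -- to `one-heavy`; if there is none, the light degree of z or of x is small.
  classify : ∀ {x y z} → H x y z → ¬ Structured O x y z → Kind₆ x y z
  classify {x} {y} {z} h ¬s with heavy? x y | heavy? x z | heavy? y z
  ... | yes xy | yes xz | yes yz = π₁ (inj₂ (inj₁ (xy , xz , yz)))
  ... | no ¬xy | yes xz | yes yz =
    let o , o′ = two-heavy xz yz ¬xy (irr h) in contradiction (sink₃ o o′) ¬s
  ... | yes xy | no ¬xz | yes yz =
    let o , o′ = two-heavy xy (heavy-sym yz) ¬xz (irr₁₃ h) in contradiction (sink₂ o o′) ¬s
  ... | yes xy | yes xz | no ¬yz =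
    let o , o′ = two-heavy (heavy-sym xy) (heavy-sym xz) ¬yz (irr₂₃ h) in contradiction (sink₁ o o′) ¬s
  ... | yes xy | no ¬xz | no ¬yz with one-heavy h xy ¬xz ¬yz
  ...   | inj₁ s = contradiction s ¬s
  ...   | inj₂ (inj₁ k) = π₁ k
  ...   | inj₂ (inj₂ k) = π₂ k
  classify {x} {y} {z} h ¬s | no ¬xy | no ¬xz | yes yz
    with one-heavy (turn h) yz (¬xy ∘ heavy-sym) (¬xz ∘ heavy-sym)
  ...   | inj₁ s = contradiction (rotate {O = O} (rotate {O = O} s)) ¬s
  ...   | inj₂ (inj₁ k) = π₃ k
  ...   | inj₂ (inj₂ k) = π₄ k
  classify {x} {y} {z} h ¬s | no ¬xy | yes xz | no ¬yz
    with one-heavy (turn (turn h)) (heavy-sym xz) (¬yz ∘ heavy-sym) ¬xy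
  ...   | inj₁ s = contradiction (rotate {O = O} s) ¬s
  ...   | inj₂ (inj₁ k) = π₅ k
  ...   | inj₂ (inj₂ k) = π₆ k
  classify {x} {y} {z} h ¬s | no ¬xy | no ¬xz | no ¬yz
    with light-degree z ≤? 8 * C | light-degree x ≤? 8 * C
  ... | yes small | _ = π₁ (inj₁ ((h , ¬xy , ¬xz , ¬yz) , small))
  ... | no _ | yes small = π₃ (inj₁ ((turn h , ¬yz , ¬xy ∘ heavy-sym , ¬xz ∘ heavy-sym) , small))
  ... | no bz | no bx = ⊥-elim (no-two-big h (≰⇒> bx) (≰⇒> bz))

  -- The factor `C` avoids a division in `busy-count`. Per colour there are O(C n + n²/C)
  -- exceptional triples.
  exceptional-count : C * sum (λ x → sum (λ y → count (exceptional? x y))) ≤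
                      6 * (n * (C * (14 * C + 12)) + 2 * n * n)
  exceptional-count = begin
    C * sum₃ (λ x y z → ι (exceptional? x y z))
      ≤⟨ *-monoʳ-≤ C (sum₃-mono λ x y z → ι≤ (exceptional? x y z) λ (h , ¬s) → kind₆⇒orbit (classify h ¬s)) ⟩
    C * sum₃ (orbit weight)
      ≡⟨ cong (C *_) (sum₃-orbit weight) ⟩
    C * (6 * sum₃ weight)
      ≡⟨ cong (λ s → C * (6 * s)) (trans (sum-cong (λ x → sum-comm (weight x))) (sum-comm (λ x z → sum (λ y → weight x y z)))) ⟩
    C * (6 * sum (λ z → sum (λ x → sum (λ y → weight x y z))))
      ≤⟨ *-monoʳ-≤ C (*-monoʳ-≤ 6 (sum-mono weight-at)) ⟩
    C * (6 * sum (λ z → 14 * C + 12 + ι (busy? z) * n))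
      ≡⟨ cong (λ s → C * (6 * s)) (trans (sum-+ (λ _ → 14 * C + 12) (λ z → ι (busy? z) * n))
           (cong₂ _+_ (sum-const n (14 * C + 12)) (sum-*ʳ n (ι ∘ busy?)))) ⟩
    C * (6 * (n * (14 * C + 12) + count busy? * n))
      ≡⟨ regroup C n (count busy?) ⟩
    6 * (n * (C * (14 * C + 12)) + C * count busy? * n)
      ≤⟨ *-monoʳ-≤ 6 (+-monoʳ-≤ (n * (C * (14 * C + 12))) (*-monoˡ-≤ n busy-count)) ⟩
    6 * (n * (C * (14 * C + 12)) + 2 * n * n) ∎
    where
    open ≤-Reasoning
    regroup : ∀ C n b → C * (6 * (n * (14 * C + 12) + b * n)) ≡ 6 * (n * (C * (14 * C + 12)) + C * b * n)
    regroup = solve-∀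

-- Digraphs in which almost every triple has a sink

module _ {n : ℕ} {P : Fin n → Set} (P? : ∀ i → Dec (P i)) where

  sum-over : ∀ {f : Fin n → ℕ} {b} → (∀ i → P i → f i ≤ b) → sum (λ i → ι (P? i) * f i) ≤ count P? * b
  sum-over {b = b} f≤b = ≤-trans (sum-mono (λ i → ι*-mono (P? i) (f≤b i))) (≤-reflexive (sum-*ʳ b (ι ∘ P?)))

  over-sum : ∀ {m} (g : Fin n → Fin m → ℕ) →
             sum (λ i → sum (λ j → ι (P? i) * g i j)) ≡ sum (λ i → ι (P? i) * sum (g i))
  over-sum g = sum-cong (λ i → sum-*ˡ (ι (P? i)) (g i))

  markov : ∀ (f : Fin n → ℕ) t → (∀ i → P i → t ≤ f i) → count P? * t ≤ sum f
  markov f t t≤f = ≤-trans (≤-reflexive (sym (sum-*ʳ t (ι ∘ P?)))) (sum-mono (λ i → ι*≤ (P? i) (t≤f i)))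

left : ∀ {m n} o → m ≤ n → m ≤ n + o
left = m≤n⇒m≤n+o

right : ∀ {m n} o → m ≤ n → m ≤ o + n
right = m≤n⇒m≤o+n

-- If x ⇒ y, y ⇒ z and z ⇒ x were all absent, the reverse arrows would form a one-way directed
-- triangle; `sink` excludes this outside `Exc`. All errors are measured by `u`.
module Digraph {n : ℕ} (_⇒_ : Fin n → Fin n → Set) (_⇒?_ : ∀ x y → Dec (x ⇒ y))
  (Exc : Fin n → Fin n → Fin n → Set) (exc? : ∀ x y z → Dec (Exc x y z)) (u : ℕ) (3≤u : 3 ≤ u)
  (adjacent : ∀ {x y} → x ≢ y → count (exc? x y) ≤ u → x ⇒ y ⊎ y ⇒ x)
  (sink : ∀ {x y z} → x ≢ y → y ≢ z → x ≢ z → ¬ Exc x y z → ¬ x ⇒ y → z ⇒ x ⊎ y ⇒ z)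
  (X : Fin n → Set) (X? : ∀ x → Dec (X x)) (H : ℕ)
  (out≤H : ∀ w → X w → count (λ y → X? y ×-dec w ⇒? y) ≤ H)
  (tame : ∀ w → X w → sum (λ z → count (exc? w z)) ≤ u * u)
  (few-bad : ∀ w → X w → count (λ z → u <? count (exc? w z)) ≤ u) where

  private
    V = Fin n

  e : V → V → ℕ
  e x y = count (exc? x y)

  x : ℕ
  x = count X?

  ins outs : V → ℕ
  ins  w = count (λ y → X? y ×-dec y ⇒? w)
  outs w = count (λ y → X? y ×-dec w ⇒? y)

  module _ (w : V) (Xw : X w) where

    -- Up to errors, the vertices of `X` with a one-way arrow to w.
    N : V → Set
    N z = X z × w ≢ z × ¬ u < e w z × ¬ w ⇒ z

    N? : ∀ z → Dec (N z)
    N? z = X? z ×-dec (¬? (w ≟ z) ×-dec (¬? (u <? e w z) ×-dec ¬? (w ⇒? z)))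

    p : ℕ
    p = count N?

    N⇒w : ∀ {z} → N z → z ⇒ w
    N⇒w (_ , w≢z , ¬bad , ¬wz) with adjacent w≢z (≮⇒≥ ¬bad)
    ... | inj₁ wz = contradiction wz ¬wz
    ... | inj₂ zw = zw

    beyond within : V → ℕ
    beyond z = count (λ y → X? y ×-dec (z ⇒? y ×-dec ¬? (y ⇒? w)))
    within z = count (λ y → N? y ×-dec z ⇒? y)

    A B : ℕ
    A = sum (λ z → ι (N? z) * beyond z)
    B = sum (λ z → ι (N? z) * within z)

    N-large : x ≤ p + (outs w + (1 + u))
    N-large = begin
      x
        ≤⟨ sum-mono pointwise ⟩
      sum (λ z → ι (N? z) + (ι (X? z ×-dec w ⇒? z) + (ι (w ≟ z) + ι (u <? e w z))))
        ≡⟨ trans (sum-+ (ι ∘ N?) _) (cong (p +_) (trans (sum-+ (λ z → ι (X? z ×-dec w ⇒? z)) _)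
             (cong (outs w +_) (sum-+ (λ z → ι (w ≟ z)) (λ z → ι (u <? e w z)))))) ⟩
      p + (outs w + (count (w ≟_) + count (λ z → u <? e w z)))
        ≤⟨ +-monoʳ-≤ p (+-monoʳ-≤ (outs w) (+-mono-≤ (count-unique (w ≟_) λ { _ _ refl refl → refl }) (few-bad w Xw))) ⟩
      p + (outs w + (1 + u)) ∎
      where
      open ≤-Reasoning
      pointwise : ∀ z → ι (X? z) ≤ ι (N? z) + (ι (X? z ×-dec w ⇒? z) + (ι (w ≟ z) + ι (u <? e w z)))
      pointwise z = ι≤ (X? z) (split (w ⇒? z) (w ≟ z) (u <? e w z))
        where
        split : Dec (w ⇒ z) → Dec (w ≡ z) → Dec (u < e w z) → X z →
                1 ≤ ι (N? z) + (ι (X? z ×-dec w ⇒? z) + (ι (w ≟ z) + ι (u <? e w z)))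
        split (yes a) _ _ Xz = right (ι (N? z)) (left _ (1≤ι (X? z ×-dec w ⇒? z) (Xz , a)))
        split (no a) (yes b) _ Xz = right (ι (N? z)) (right (ι (X? z ×-dec w ⇒? z)) (left _ (1≤ι (w ≟ z) b)))
        split (no a) (no b) (yes c) Xz =
          right (ι (N? z)) (right (ι (X? z ×-dec w ⇒? z)) (right (ι (w ≟ z)) (1≤ι (u <? e w z) c)))
        split (no a) (no b) (no c) Xz = left _ (1≤ι (N? z) (Xz , b , c , a))

    -- A non-out-neighbour z of w sends an edge to every y which sends none to w.
    escape : p * x ≤ p * ins w + (A + (u * u + p * 1))
    escape = begin
      p * x
        ≡⟨ sum-*ʳ x (ι ∘ N?) ⟨
      sum (λ z → ι (N? z) * x)
        ≡⟨ over-sum N? (λ _ y → ι (X? y)) ⟨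
      sum (λ z → sum (λ y → ι (N? z) * ι (X? y)))
        ≤⟨ sum₂-mono pointwise ⟩
      sum (λ z → sum (λ y → f₁ z y + (f₂ z y + (f₃ z y + f₄ z y))))
        ≡⟨ trans (sum₂-+ f₁ _) (cong (s₁ +_) (trans (sum₂-+ f₂ _) (cong (s₂ +_) (sum₂-+ f₃ f₄)))) ⟩
      s₁ + (s₂ + (sum (e w) + s₄))
        ≡⟨ cong₂ _+_ (over-sum N? (λ _ y → ι (X? y ×-dec y ⇒? w)))
             (cong₂ _+_ (over-sum N? (λ z y → ι (X? y ×-dec (z ⇒? y ×-dec ¬? (y ⇒? w)))))
               (cong (sum (e w) +_) (over-sum N? (λ _ y → ι (y ≟ w))))) ⟩
      sum (λ z → ι (N? z) * ins w) + (A + (sum (e w) + sum (λ z → ι (N? z) * count (_≟ w))))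
        ≤⟨ +-mono-≤ (≤-reflexive (sum-*ʳ (ins w) (ι ∘ N?))) (+-monoʳ-≤ A (+-mono-≤ (tame w Xw)
             (sum-over N? (λ _ _ → count-unique (_≟ w) λ { _ _ refl refl → refl })))) ⟩
      p * ins w + (A + (u * u + p * 1)) ∎
      where
      open ≤-Reasoning
      f₁ f₂ f₃ f₄ : V → V → ℕ
      f₁ z y = ι (N? z) * ι (X? y ×-dec y ⇒? w)
      f₂ z y = ι (N? z) * ι (X? y ×-dec (z ⇒? y ×-dec ¬? (y ⇒? w)))
      f₃ z y = ι (exc? w z y)
      f₄ z y = ι (N? z) * ι (y ≟ w)
      s₁ s₂ s₄ : ℕ
      s₁ = sum (λ z → sum (f₁ z))
      s₂ = sum (λ z → sum (f₂ z))
      s₄ = sum (λ z → sum (f₄ z))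
      pointwise : ∀ z y → ι (N? z) * ι (X? y) ≤ f₁ z y + (f₂ z y + (f₃ z y + f₄ z y))
      pointwise z y = ι*≤ (N? z) λ Nz → ι≤ (X? y) (split Nz (y ⇒? w) (exc? w z y) (y ≟ w))
        where
        split : N z → Dec (y ⇒ w) → Dec (Exc w z y) → Dec (y ≡ w) → X y →
                1 ≤ f₁ z y + (f₂ z y + (f₃ z y + f₄ z y))
        split Nz (yes a) _ _ Xy = left _ (*-mono-≤ (1≤ι (N? z) Nz) (1≤ι (X? y ×-dec y ⇒? w) (Xy , a)))
        split Nz (no _) (yes b) _ Xy = right (f₁ z y) (right (f₂ z y) (left _ (1≤ι (exc? w z y) b)))
        split Nz (no _) (no _) (yes c) Xy =
          right (f₁ z y) (right (f₂ z y) (right (f₃ z y) (*-mono-≤ (1≤ι (N? z) Nz) (1≤ι (y ≟ w) c))))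
        split Nz@(_ , w≢z , _ , ¬wz) (no a) (no b) (no c) Xy
          with sink w≢z (λ { refl → a (N⇒w Nz) }) (≢-sym c) b ¬wz
        ... | inj₁ yw = contradiction yw a
        ... | inj₂ zy = right (f₁ z y) (left _ (*-mono-≤ (1≤ι (N? z) Nz)
                          (1≤ι (X? y ×-dec (z ⇒? y ×-dec ¬? (y ⇒? w))) (Xy , zy , a))))

    -- Every vertex of `N` sends an arrow to w, so `beyond` and `within` count disjoint sets of
    -- out-neighbours.
    room : A + B ≤ p * H
    room = begin
      A + B
        ≡⟨ sum-+ (λ z → ι (N? z) * beyond z) (λ z → ι (N? z) * within z) ⟨
      sum (λ z → ι (N? z) * beyond z + ι (N? z) * within z)
        ≡⟨ sum-cong (λ z → *-distribˡ-+ (ι (N? z)) (beyond z) (within z)) ⟨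
      sum (λ z → ι (N? z) * (beyond z + within z))
        ≤⟨ sum-over N? (λ z (Xz , _) → ≤-trans (disjoint z) (out≤H z Xz)) ⟩
      p * H ∎
      where
      open ≤-Reasoning
      disjoint : ∀ z → beyond z + within z ≤ outs z
      disjoint z = ≤-trans (≤-reflexive (sym (sum-+ (λ y → ι (X? y ×-dec (z ⇒? y ×-dec ¬? (y ⇒? w)))) _)))
        (sum-mono λ y → split y (z ⇒? y) (y ⇒? w))
        where
        split : ∀ y → Dec (z ⇒ y) → Dec (y ⇒ w) →
                ι (X? y ×-dec (z ⇒? y ×-dec ¬? (y ⇒? w))) + ι (N? y ×-dec z ⇒? y) ≤ ι (X? y ×-dec z ⇒? y)
        split y _ (yes yw) = ≤-trans
          (+-monoˡ-≤ _ (≤-reflexive (ι-no (X? y ×-dec (z ⇒? y ×-dec ¬? (y ⇒? w))) λ (_ , _ , ¬yw) → ¬yw yw)))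
          (ι-mono (N? y ×-dec z ⇒? y) (X? y ×-dec z ⇒? y) λ ((Xy , _) , zy) → Xy , zy)
        split y _ (no ¬yw) = ≤-trans
          (+-monoʳ-≤ _ (≤-reflexive (ι-no (N? y ×-dec z ⇒? y) λ (Ny , _) → ¬yw (N⇒w Ny))))
          (≤-trans (≤-reflexive (+-identityʳ _))
            (ι-mono (X? y ×-dec (z ⇒? y ×-dec ¬? (y ⇒? w))) (X? y ×-dec z ⇒? y) λ (Xy , zy , _) → Xy , zy))

    semicomplete : p * p ≤ B + (B + (p * 1 + p * u))
    semicomplete = begin
      p * p
        ≡⟨ sum-*ʳ p (ι ∘ N?) ⟨
      sum (λ z → ι (N? z) * p)
        ≡⟨ over-sum N? (λ _ y → ι (N? y)) ⟨
      sum (λ z → sum (λ y → ι (N? z) * ι (N? y)))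
        ≤⟨ sum₂-mono pointwise ⟩
      sum (λ z → sum (λ y → f₁ z y + (f₁ y z + (f₃ z y + f₄ z y))))
        ≡⟨ trans (sum₂-+ f₁ _) (cong (s₁ +_) (trans (sum₂-+ (λ z y → f₁ y z) _)
             (cong₂ _+_ (sum-comm (λ z y → f₁ y z)) (sum₂-+ f₃ f₄)))) ⟩
      s₁ + (s₁ + (s₃ + s₄))
        ≡⟨ cong₂ _+_ B≡ (cong₂ _+_ B≡ (cong₂ _+_ (over-sum N? (λ z y → ι (z ≟ y)))
             (over-sum N? (λ z y → ι (u <? e z y))))) ⟩
      B + (B + (sum (λ z → ι (N? z) * count (z ≟_)) + sum (λ z → ι (N? z) * count (λ y → u <? e z y))))
        ≤⟨ +-monoʳ-≤ B (+-monoʳ-≤ B (+-mono-≤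
             (sum-over N? (λ z _ → count-unique (z ≟_) λ { _ _ refl refl → refl }))
             (sum-over N? (λ z (Xz , _) → few-bad z Xz)))) ⟩
      B + (B + (p * 1 + p * u)) ∎
      where
      open ≤-Reasoning
      f₁ f₃ f₄ : V → V → ℕ
      f₁ z y = ι (N? z) * ι (N? y ×-dec z ⇒? y)
      f₃ z y = ι (N? z) * ι (z ≟ y)
      f₄ z y = ι (N? z) * ι (u <? e z y)
      s₁ s₃ s₄ : ℕ
      s₁ = sum (λ z → sum (f₁ z))
      s₃ = sum (λ z → sum (f₃ z))
      B≡ : s₁ ≡ B
      B≡ = over-sum N? (λ z y → ι (N? y ×-dec z ⇒? y))
      s₄ = sum (λ z → sum (f₄ z))
      pointwise : ∀ z y → ι (N? z) * ι (N? y) ≤ f₁ z y + (f₁ y z + (f₃ z y + f₄ z y))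
      pointwise z y = ι*≤ (N? z) λ Nz → ι≤ (N? y) (split Nz (z ≟ y) (u <? e z y))
        where
        split : N z → Dec (z ≡ y) → Dec (u < e z y) → N y → 1 ≤ f₁ z y + (f₁ y z + (f₃ z y + f₄ z y))
        split Nz (yes a) _ Ny = right (f₁ z y) (right (f₁ y z) (left _ (*-mono-≤ (1≤ι (N? z) Nz) (1≤ι (z ≟ y) a))))
        split Nz (no _) (yes b) Ny =
          right (f₁ z y) (right (f₁ y z) (right (f₃ z y) (*-mono-≤ (1≤ι (N? z) Nz) (1≤ι (u <? e z y) b))))
        split Nz (no a) (no b) Ny with adjacent a (≮⇒≥ b)
        ... | inj₁ zy = left _ (*-mono-≤ (1≤ι (N? z) Nz) (1≤ι (N? y ×-dec z ⇒? y) (Ny , zy)))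
        ... | inj₂ yz = right (f₁ z y) (left _ (*-mono-≤ (1≤ι (N? y) Ny) (1≤ι (N? z ×-dec y ⇒? z) (Nz , yz))))

    -- Up to errors, `escape`, `room` and `semicomplete` combine to p (2x + p) ≤ p (2 ins + 2H).
    -- Divide by p and insert p ≥ x - outs from `N-large`.
    local : 3 * x ≤ 2 * H + 2 * ins w + outs w + 7 * u
    local with u ≤? p
    -- Here `p` is too small to absorb the error `u * u`, but then almost all of `X` consists of
    -- out-neighbours of w.
    ... | no  u≰p = linear (3 * x) (2 * H + 2 * ins w + outs w + 7 * u) (2 * ins w)
      (+-mono-≤ (*-monoʳ-≤ 3 N-large) (+-mono-≤ (*-monoʳ-≤ 3 (<⇒≤ (≰⇒> u≰p))) (+-mono-≤ (*-monoʳ-≤ 2 (out≤H w Xw)) 3≤u)))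
      (small x p (outs w) u H (ins w))
      where
      small : ∀ x p o u H i →
        3 * x + (3 * (p + (o + (1 + u))) + (3 * u + (2 * H + u))) + 2 * i ≡
        2 * H + 2 * i + o + 7 * u + (3 * x + (3 * p + (2 * o + 3)))
      small = solve-∀
    ... | yes u≤p = linear (3 * x) (2 * H + 2 * ins w + outs w + 7 * u) (2 + u)
      (+-mono-≤ N-large (+-mono-≤ divided (+-mono-≤ 3≤u 3≤u))) (sumup x p (outs w) u H (ins w))
      where
      0<p : 0 < p
      0<p = ≤-trans (≤-trans (s≤s z≤n) 3≤u) u≤p
      combined : p * (2 * x + p) ≤ p * (2 * ins w + 2 * H + 3 + 3 * u)
      combined = linear (p * (2 * x + p)) (p * (2 * ins w + 2 * H + 3 + 3 * u)) 0
        (+-mono-≤ (*-monoʳ-≤ 2 escape) (+-mono-≤ (*-monoʳ-≤ 2 room) (+-mono-≤ semicomplete (*-monoˡ-≤ u (*-monoʳ-≤ 2 u≤p)))))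
        (eq p x H u (ins w) A B)
        where
        eq : ∀ p x H u i A B →
          p * (2 * x + p) + (2 * (p * i + (A + (u * u + p * 1))) + (2 * (p * H) + (B + (B + (p * 1 + p * u)) + 2 * p * u))) + 0 ≡
          p * (2 * i + 2 * H + 3 + 3 * u) + (2 * (p * x) + (2 * (A + B) + (p * p + 2 * u * u)))
        eq = solve-∀
      divided : 2 * x + p ≤ 2 * ins w + 2 * H + 3 + 3 * u
      divided = *-cancelˡ-≤ p {{>-nonZero 0<p}} combined
      sumup : ∀ x p o u H i →
        3 * x + (p + (o + (1 + u)) + (2 * i + 2 * H + 3 + 3 * u + (u + u))) + (2 + u) ≡
        2 * H + 2 * i + o + 7 * u + (x + (2 * x + p + (3 + 3)))
      sumup = solve-∀

  -- Average `local` over w in `X`: in-degrees and out-degrees inside `X` have the same sum, at most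
  -- `x * H`.
  conclusion : 3 * x ≤ 5 * H + 7 * u
  conclusion with x in x≡
  ... | zero = z≤n
  ... | suc x₀ = *-cancelˡ-≤ (suc x₀) (subst (λ x → x * (3 * x) ≤ x * (5 * H + 7 * u)) x≡ total)
    where
    open ≤-Reasoning
    I J : ℕ
    I = sum (λ w → ι (X? w) * ins w)
    J = sum (λ w → ι (X? w) * outs w)
    J≤ : J ≤ x * H
    J≤ = sum-over X? out≤H
    I≡J : I ≡ J
    I≡J = trans (sym (over-sum X? (λ w y → ι (X? y ×-dec y ⇒? w))))
      (trans (trans (sum-cong (λ w → sum-cong (exchange w))) (sum-comm (λ w y → ι (X? y) * ι (X? w ×-dec y ⇒? w))))
             (over-sum X? (λ y w → ι (X? w ×-dec y ⇒? w))))
      where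
      exchange : ∀ w y → ι (X? w) * ι (X? y ×-dec y ⇒? w) ≡ ι (X? y) * ι (X? w ×-dec y ⇒? w)
      exchange w y = trans (cong (ι (X? w) *_) (ι-× (X? y) (y ⇒? w)))
        (trans (commute (ι (X? w)) (ι (X? y)) (ι (y ⇒? w))) (cong (ι (X? y) *_) (sym (ι-× (X? w) (y ⇒? w)))))
        where
        commute : ∀ a b c → a * (b * c) ≡ b * (a * c)
        commute = solve-∀
    expand : ∀ a H i o u → a * (2 * H + 2 * i + o + 7 * u) ≡ a * (2 * H + 7 * u) + (2 * (a * i) + a * o)
    expand = solve-∀
    total : x * (3 * x) ≤ x * (5 * H + 7 * u)
    total = begin
      x * (3 * x)
        ≡⟨ sum-*ʳ (3 * x) (ι ∘ X?) ⟨
      sum (λ w → ι (X? w) * (3 * x))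
        ≤⟨ sum-mono (λ w → ι*-mono (X? w) (local w)) ⟩
      sum (λ w → ι (X? w) * (2 * H + 2 * ins w + outs w + 7 * u))
        ≡⟨ sum-cong (λ w → expand (ι (X? w)) H (ins w) (outs w) u) ⟩
      sum (λ w → ι (X? w) * (2 * H + 7 * u) + (2 * (ι (X? w) * ins w) + ι (X? w) * outs w))
        ≡⟨ trans (sum-+ (λ w → ι (X? w) * (2 * H + 7 * u)) _) (cong₂ _+_ (sum-*ʳ (2 * H + 7 * u) (ι ∘ X?))
             (trans (sum-+ (λ w → 2 * (ι (X? w) * ins w)) _) (cong (_+ J) (sum-*ˡ 2 (λ w → ι (X? w) * ins w))))) ⟩
      x * (2 * H + 7 * u) + (2 * I + J)
        ≡⟨ cong (λ i → x * (2 * H + 7 * u) + (2 * i + J)) I≡J ⟩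
      x * (2 * H + 7 * u) + (2 * J + J)
        ≤⟨ +-monoʳ-≤ (x * (2 * H + 7 * u)) (+-mono-≤ (*-monoʳ-≤ 2 J≤) J≤) ⟩
      x * (2 * H + 7 * u) + (2 * (x * H) + x * H)
        ≡⟨ collect x H u ⟩
      x * (5 * H + 7 * u) ∎
      where
      collect : ∀ x H u → x * (2 * H + 7 * u) + (2 * (x * H) + x * H) ≡ x * (5 * H + 7 * u)
      collect = solve-∀

-- Counting arrows over all colours

witness : ∀ {n} {P : Fin n → Set} (P? : ∀ i → Dec (P i)) → 1 ≤ count P? → ∃ P
witness P? 1≤ = let i , p , _ = pick P? [] 1≤ in i , p

2xy≤x²+y² : ∀ x y → 2 * (x * y) ≤ x * x + y * y
2xy≤x²+y² x y with ≤-total x y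
... | inj₁ x≤y with m≤n⇒∃[o]m+o≡n x≤y
...   | d , refl = linear (2 * (x * (x + d))) (x * x + (x + d) * (x + d)) (d * d) (z≤n {0}) (eq x d)
  where
  eq : ∀ x d → 2 * (x * (x + d)) + 0 + d * d ≡ x * x + (x + d) * (x + d) + 0
  eq = solve-∀
2xy≤x²+y² x y | inj₂ y≤x with m≤n⇒∃[o]m+o≡n y≤x
...   | d , refl = linear (2 * ((y + d) * y)) ((y + d) * (y + d) + y * y) (d * d) (z≤n {0}) (eq y d)
  where
  eq : ∀ y d → 2 * ((y + d) * y) + 0 + d * d ≡ (y + d) * (y + d) + y * y + 0
  eq = solve-∀

-- For Λ = b + 23 v + t it remains to see 15 b² + 339 v² > 141 b v, which is AM-GM for
-- 10 b and 47 v.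
quadratic : ∀ {b v Λ} → b + 23 * v ≤ Λ →
  15 * (Λ * Λ) ≤ 330 * v * Λ + (501 * (b * v) + 6 * (v * v)) → v * v ≤ 0
quadratic {b} {v} lower upper with m≤n⇒∃[o]m+o≡n lower
... | t , refl = *-cancelˡ-≤ 153 (linear (153 * (v * v)) (153 * 0) (300 * (t * (2 * b + 24 * v) + t * t))
  (+-mono-≤ (*-monoʳ-≤ 20 upper) (*-monoʳ-≤ 3 (2xy≤x²+y² (10 * b) (47 * v)))) (eq b v t))
  where
  eq : ∀ b v t →
    153 * (v * v) + (20 * (330 * v * (b + 23 * v + t) + (501 * (b * v) + 6 * (v * v))) +
      3 * (10 * b * (10 * b) + 47 * v * (47 * v))) + 300 * (t * (2 * b + 24 * v) + t * t) ≡
    153 * 0 + (20 * (15 * ((b + 23 * v + t) * (b + 23 * v + t))) + 3 * (2 * (10 * b * (47 * v))))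
  eq = solve-∀

-- The ends have weights 1 + i and 1 + j, and a, b count the arrows each way. Two arrows always
-- suffice. A lone arrow falls short only if its head has weight 2, by at most 2, which the term
-- with σ or τ pays.
min-cost : ∀ {i j} a b σ τ r → i ≤ 1 → j ≤ 1 → 1 ≤ a + b → (a ≡ 1 → b ≡ 0 → 1 ≤ σ) → (b ≡ 1 → a ≡ 0 → 1 ≤ τ) →
  (1 + i) * (1 + j) ≤ (1 + i) * a + ((1 + j) * b + (2 * (j * σ) + (2 * (i * τ) + r)))
min-cost {i} {j} (suc zero) zero σ τ r i≤1 j≤1 _ single _ =
  linear ((1 + i) * (1 + j)) ((1 + i) * 1 + ((1 + j) * 0 + (2 * (j * σ) + (2 * (i * τ) + r)))) (2 * (i * τ) + r)
    (+-mono-≤ (*-monoʳ-≤ (2 * j) (single refl refl)) (*-monoˡ-≤ j i≤1)) (eq i j σ τ r)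
  where
  eq : ∀ i j σ τ r → (1 + i) * (1 + j) + (2 * j * σ + 1 * j) + (2 * (i * τ) + r) ≡
    (1 + i) * 1 + ((1 + j) * 0 + (2 * (j * σ) + (2 * (i * τ) + r))) + (2 * j * 1 + i * j)
  eq = solve-∀
min-cost {i} {j} zero (suc zero) σ τ r i≤1 j≤1 _ _ single =
  linear ((1 + i) * (1 + j)) ((1 + i) * 0 + ((1 + j) * 1 + (2 * (j * σ) + (2 * (i * τ) + r)))) (2 * (j * σ) + r)
    (+-mono-≤ (*-monoʳ-≤ (2 * i) (single refl refl)) (*-monoʳ-≤ i j≤1)) (eq i j σ τ r)
  where
  eq : ∀ i j σ τ r → (1 + i) * (1 + j) + (2 * i * τ + i * 1) + (2 * (j * σ) + r) ≡
    (1 + i) * 0 + ((1 + j) * 1 + (2 * (j * σ) + (2 * (i * τ) + r))) + (2 * i * 1 + i * j)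
  eq = solve-∀
min-cost {i} {j} (suc (suc a)) b σ τ r i≤1 j≤1 _ _ _ =
  linear ((1 + i) * (1 + j)) ((1 + i) * (2 + a) + ((1 + j) * b + (2 * (j * σ) + (2 * (i * τ) + r))))
    ((1 + i) * a + ((1 + j) * b + (2 * (j * σ) + (2 * (i * τ) + r)))) (*-monoʳ-≤ (1 + i) j≤1) (eq i j a b σ τ r)
  where
  eq : ∀ i j a b σ τ r → (1 + i) * (1 + j) + (1 + i) * 1 + ((1 + i) * a + ((1 + j) * b + (2 * (j * σ) + (2 * (i * τ) + r)))) ≡
    (1 + i) * (2 + a) + ((1 + j) * b + (2 * (j * σ) + (2 * (i * τ) + r))) + (1 + i) * j
  eq = solve-∀
min-cost {i} {j} a (suc (suc b)) σ τ r i≤1 j≤1 _ _ _ =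
  linear ((1 + i) * (1 + j)) ((1 + i) * a + ((1 + j) * (2 + b) + (2 * (j * σ) + (2 * (i * τ) + r))))
    ((1 + i) * a + ((1 + j) * b + (2 * (j * σ) + (2 * (i * τ) + r)))) (*-monoˡ-≤ (1 + j) i≤1) (eq i j a b σ τ r)
  where
  eq : ∀ i j a b σ τ r → (1 + i) * (1 + j) + 1 * (1 + j) + ((1 + i) * a + ((1 + j) * b + (2 * (j * σ) + (2 * (i * τ) + r)))) ≡
    (1 + i) * a + ((1 + j) * (2 + b) + (2 * (j * σ) + (2 * (i * τ) + r))) + i * (1 + j)
  eq = solve-∀
min-cost {i} {j} (suc zero) (suc zero) σ τ r i≤1 j≤1 _ _ _ =
  linear ((1 + i) * (1 + j)) ((1 + i) * 1 + ((1 + j) * 1 + (2 * (j * σ) + (2 * (i * τ) + r))))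
    (2 * (j * σ) + (2 * (i * τ) + r)) (*-mono-≤ i≤1 j≤1) (eq i j σ τ r)
  where
  eq : ∀ i j σ τ r → (1 + i) * (1 + j) + 1 * 1 + (2 * (j * σ) + (2 * (i * τ) + r)) ≡
    (1 + i) * 1 + ((1 + j) * 1 + (2 * (j * σ) + (2 * (i * τ) + r))) + i * j
  eq = solve-∀

-- Sum the hypothesis over all ordered pairs; arrows counted by the weight of their tail contribute
-- at most `sum w * k` in each direction.
weighted-count : ∀ {n k} (w : Fin n → ℕ) (a s bad : Fin n → Fin n → ℕ) → (∀ x → sum (a x) ≤ k) →
  (∀ x y → w x * w y ≤ w x * a x y + (w y * a y x + (2 * s x y + (2 * s y x + 4 * bad x y)))) →
  let S = sum (λ y → sum (λ x → s x y)); Bad = sum (λ x → sum (bad x)) in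
  sum w * sum w ≤ sum w * k + (sum w * k + (2 * S + (2 * S + 4 * Bad)))
weighted-count {n} {k} w a s bad out-degree cost = begin
  sum w * sum w
    ≡⟨ sum-*ʳ (sum w) w ⟨
  sum (λ x → w x * sum w)
    ≡⟨ sum-cong (λ x → sum-*ˡ (w x) w) ⟨
  sum (λ x → sum (λ y → w x * w y))
    ≤⟨ sum₂-mono cost ⟩
  sum (λ x → sum (λ y → out x y + (out y x + charges x y)))
    ≡⟨ trans (sum₂-+ out (λ x y → out y x + charges x y)) (cong (sum (λ x → sum (out x)) +_)
         (trans (sum₂-+ (λ x y → out y x) charges) (cong₂ _+_ (sum-comm (λ x y → out y x)) charges≡))) ⟩
  sum (λ x → sum (out x)) + (sum (λ x → sum (out x)) + (2 * S + (2 * S + 4 * Bad)))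
    ≤⟨ +-mono-≤ out≤ (+-monoˡ-≤ (2 * S + (2 * S + 4 * Bad)) out≤) ⟩
  sum w * k + (sum w * k + (2 * S + (2 * S + 4 * Bad))) ∎
  where
  open ≤-Reasoning
  S Bad : ℕ
  S   = sum (λ y → sum (λ x → s x y))
  Bad = sum (λ x → sum (bad x))
  out charges : Fin n → Fin n → ℕ
  out     x y = w x * a x y
  charges x y = 2 * s x y + (2 * s y x + 4 * bad x y)
  out≤ : sum (λ x → sum (out x)) ≤ sum w * k
  out≤ = ≤-trans (≤-reflexive (sum-cong (λ x → sum-*ˡ (w x) (a x))))
    (≤-trans (sum-mono (λ x → *-monoʳ-≤ (w x) (out-degree x))) (≤-reflexive (sum-*ʳ k w)))
  scale : ∀ c (f : Fin n → Fin n → ℕ) → sum (λ x → sum (λ y → c * f x y)) ≡ c * sum (λ x → sum (f x))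
  scale c f = trans (sum-cong (λ x → sum-*ˡ c (f x))) (sum-*ˡ c (sum ∘ f))
  charges≡ : sum (λ x → sum (charges x)) ≡ 2 * S + (2 * S + 4 * Bad)
  charges≡ = trans (sum₂-+ (λ x y → 2 * s x y) (λ x y → 2 * s y x + 4 * bad x y))
    (cong₂ _+_ (trans (scale 2 s) (cong (2 *_) (sum-comm s)))
      (trans (sum₂-+ (λ x y → 2 * s y x) (λ x y → 4 * bad x y)) (cong₂ _+_ (scale 2 (λ x y → s y x)) (scale 4 bad))))

1≤m+n⇒1≤m⊎1≤n : ∀ m {n} → 1 ≤ m + n → 1 ≤ m ⊎ 1 ≤ n
1≤m+n⇒1≤m⊎1≤n zero    1≤n = inj₂ 1≤n
1≤m+n⇒1≤m⊎1≤n (suc m) _   = inj₁ (s≤s z≤n)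

-- Main terms are multiples of `v`, errors multiples of `u`, at most a thousandth of `v`. An
-- exceptional triple is one that may be unstructured in its colour; `few` counts them over all
-- colours together.
module Colours {n k : ℕ} (O : Fin k → Fin n → Fin n → Set) (O? : ∀ c x y → Dec (O c x y))
  (O-functional : ∀ {c x y y′} → O c x y → O c x y′ → y ≡ y′)
  (O-irr : ∀ {c x y} → O c x y → x ≢ y)
  (Exc : Fin n → Fin n → Fin n → Set) (exc? : ∀ x y z → Dec (Exc x y z))
  (covered : ∀ {x y z} → x ≢ y → y ≢ z → x ≢ z → ¬ Exc x y z → ∃ λ c → Structured (O c) x y z)
  (u v : ℕ) (3≤u : 3 ≤ u) (1000u≤v : u * 1000 ≤ v) (n≡17v : n ≡ 17 * v) (k≤11v : k ≤ 11 * v)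
  (few : sum₃ (λ x y z → ι (exc? x y z)) ≤ u * u * u) where

  private
    V = Fin n

  a e : V → V → ℕ
  a x y = count (λ c → O? c x y)
  e x y = count (exc? x y)

  O⇒a : ∀ {c x y} → O c x y → 1 ≤ a x y
  O⇒a {c} {x} {y} o = ≤-trans (1≤ι (O? c x y) o) (term≤sum (λ c → ι (O? c x y)) c)

  out-degree : ∀ x → sum (a x) ≤ k
  out-degree x = begin
    sum (λ y → sum (λ c → ι (O? c x y)))  ≡⟨ sum-comm (λ y c → ι (O? c x y)) ⟩
    sum (λ c → count (O? c x))            ≤⟨ sum-≤-const (λ c → count-unique (O? c x) λ _ _ → O-functional) ⟩
    k * 1                                 ≡⟨ *-identityʳ k ⟩
    k                                     ∎
    where open ≤-Reasoning

  -- If colour `c` has no arrow between x and y, any structured triple xyz has its z here, and there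
  -- is at most one such z.
  Target : V → V → Fin k → V → Set
  Target x y c z = O c x z ⊎ (NoOut (O c) x × O c y z)

  target? : ∀ x y c z → Dec (Target x y c z)
  target? x y c z = O? c x z ⊎-dec (noOut? (O? c) x ×-dec O? c y z)

  target-unique : ∀ {x y c z z′} → Target x y c z → Target x y c z′ → z ≡ z′
  target-unique (inj₁ o)       (inj₁ o′)       = O-functional o o′
  target-unique (inj₁ o)       (inj₂ (no-o , _)) = contradiction o (no-o _)
  target-unique (inj₂ (no-o , _)) (inj₁ o)       = contradiction o (no-o _)
  target-unique (inj₂ (_ , o)) (inj₂ (_ , o′)) = O-functional o o′

  -- Each colour is charged at most once: for the z outside A with xyz of that
  -- colour, or for sending x into A.
  budget : ∀ {x y} → x ≢ y → {A : V → Set} (A? : ∀ z → Dec (A z)) →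
    (∀ c z → ¬ A z → Structured (O c) x y z → Target x y c z) →
    n + sum (λ z → ι (A? z) * a x z) ≤ count A? + k + e x y + 2
  budget {x} {y} x≢y {A} A? target = begin
    n + s
      ≡⟨ cong (_+ s) (trans (sum-const n 1) (*-identityʳ n)) ⟨
    sum {n} (λ _ → 1) + s
      ≤⟨ +-monoˡ-≤ s (sum-mono pointwise) ⟩
    sum (λ z → ι (A? z) + (ι (exc? x y z) + (ι (z ≟ x) + (ι (z ≟ y) + hits z)))) + s
      ≡⟨ cong (_+ s) (trans (sum-+ (ι ∘ A?) _) (cong (count A? +_) (trans (sum-+ (λ z → ι (exc? x y z)) _) (cong (e x y +_)
           (trans (sum-+ (λ z → ι (z ≟ x)) _) (cong (count (_≟ x) +_) (sum-+ (λ z → ι (z ≟ y)) hits))))))) ⟩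
    count A? + (e x y + (count (_≟ x) + (count (_≟ y) + sum hits))) + s
      ≤⟨ +-monoˡ-≤ s (+-monoʳ-≤ (count A?) (+-monoʳ-≤ (e x y) (+-mono-≤ (one x) (+-monoˡ-≤ (sum hits) (one y))))) ⟩
    count A? + (e x y + (1 + (1 + sum hits))) + s
      ≡⟨ regroup (count A?) (e x y) (sum hits) s ⟩
    count A? + (sum hits + s) + e x y + 2
      ≤⟨ +-monoˡ-≤ 2 (+-monoˡ-≤ (e x y) (+-monoʳ-≤ (count A?) charged)) ⟩
    count A? + k + e x y + 2 ∎
    where
    open ≤-Reasoning
    hit? : ∀ c z → Dec (¬ A z × Target x y c z)
    hit? c z = ¬? (A? z) ×-dec target? x y c z
    hits : V → ℕ
    hits z = count (λ c → hit? c z)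
    s : ℕ
    s = sum (λ z → ι (A? z) * a x z)
    one : ∀ w → count (_≟ w) ≤ 1
    one w = count-unique (_≟ w) λ { _ _ refl refl → refl }
    regroup : ∀ A e h s → A + (e + (1 + (1 + h))) + s ≡ A + (h + s) + e + 2
    regroup = solve-∀
    pointwise : ∀ z → 1 ≤ ι (A? z) + (ι (exc? x y z) + (ι (z ≟ x) + (ι (z ≟ y) + hits z)))
    pointwise z = split (A? z) (exc? x y z) (z ≟ x) (z ≟ y)
      where
      split : (p : Dec (A z)) (q : Dec (Exc x y z)) (r : Dec (z ≡ x)) (s : Dec (z ≡ y)) →
              1 ≤ ι p + (ι q + (ι r + (ι s + hits z)))
      split (yes _) _ _ _ = s≤s z≤n
      split (no _) (yes _) _ _ = s≤s z≤n
      split (no _) (no _) (yes _) _ = s≤s z≤n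
      split (no _) (no _) (no _) (yes _) = s≤s z≤n
      split (no ¬A) (no ¬exc) (no z≢x) (no z≢y)
        with covered x≢y (≢-sym z≢y) (≢-sym z≢x) ¬exc
      ... | c , st = ≤-trans (1≤ι (hit? c z) (¬A , target c z ¬A st)) (term≤sum (λ c → ι (hit? c z)) c)
    charge : ∀ c z → ι (hit? c z) + ι (A? z) * ι (O? c x z) ≤ ι (target? x y c z)
    charge c z = split (A? z)
      where
      split : (d : Dec (A z)) → ι (¬? d ×-dec target? x y c z) + ι d * ι (O? c x z) ≤ ι (target? x y c z)
      split (yes _) = ≤-trans (≤-reflexive (*-identityˡ _)) (ι-mono (O? c x z) (target? x y c z) inj₁)
      split (no  _) = ≤-reflexive (+-identityʳ _)
    charged : sum hits + s ≤ k
    charged = begin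
      sum hits + s
        ≡⟨ cong₂ _+_ (sum-comm (λ z c → ι (hit? c z)))
             (trans (sym (over-sum A? (λ z c → ι (O? c x z)))) (sum-comm (λ z c → ι (A? z) * ι (O? c x z)))) ⟩
      sum (λ c → count (hit? c)) + sum (λ c → sum (λ z → ι (A? z) * ι (O? c x z)))
        ≡⟨ sum₂-+ (λ c z → ι (hit? c z)) (λ c z → ι (A? z) * ι (O? c x z)) ⟨
      sum (λ c → sum (λ z → ι (hit? c z) + ι (A? z) * ι (O? c x z)))
        ≤⟨ sum₂-mono charge ⟩
      sum (λ c → count (target? x y c))
        ≤⟨ sum-≤-const (λ c → count-unique (target? x y c) λ _ _ → target-unique) ⟩
      k * 1
        ≡⟨ *-identityʳ k ⟩
      k ∎

  1≤u : 1 ≤ u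
  1≤u = ≤-trans (s≤s z≤n) 3≤u

  instance
    u-nonZero : NonZero u
    u-nonZero = >-nonZero 1≤u

  k+u+2<n : k + u + 2 < n
  k+u+2<n = linear (suc (k + u + 2)) n (5 * v + 998 * u)
    (+-mono-≤ k≤11v (+-mono-≤ 1000u≤v (+-mono-≤ (≤-reflexive (sym n≡17v)) 3≤u))) (eq k u v n)
    where
    eq : ∀ k u v n → suc (k + u + 2) + (11 * v + (v + (n + u))) + (5 * v + 998 * u) ≡
                     n + (k + (u * 1000 + (17 * v + 3)))
    eq = solve-∀

  -- Apply `budget` with empty `A`: without an arrow the triples on xy would need distinct colours,
  -- nearly n of them and thus more than k.
  adjacent : ∀ {x y} → x ≢ y → e x y ≤ u → 1 ≤ a x y + a y x
  adjacent {x} {y} x≢y e≤u = decidable-stable (1 ≤? a x y + a y x) λ none →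
    let none′ : ∀ {c} → ¬ O c x y × ¬ O c y x
        none′ = (λ o → none (left _ (O⇒a o))) , (λ o → none (right (a x y) (O⇒a o)))
    in <⇒≱ k+u+2<n (begin
      n                                     ≤⟨ m≤m+n n _ ⟩
      n + sum (λ z → ι (empty? z) * a x z)  ≤⟨ budget x≢y empty? (λ c z _ → target (proj₁ none′) (proj₂ none′)) ⟩
      count empty? + k + e x y + 2          ≤⟨ +-monoˡ-≤ 2 (+-mono-≤ (≤-reflexive (cong (_+ k) (count-none empty? λ _ ()))) e≤u) ⟩
      k + u + 2                             ∎)
    where
    open ≤-Reasoning
    empty? : V → Dec ⊥
    empty? _ = no λ ()
    target : ∀ {c z} → ¬ O c x y → ¬ O c y x → Structured (O c) x y z → Target x y c z
    target ¬xy ¬yx (sink₁ yx _)       = contradiction yx ¬yx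
    target ¬xy ¬yx (sink₂ xy _)       = contradiction xy ¬xy
    target ¬xy ¬yx (sink₃ xz _)       = inj₁ xz
    target ¬xy ¬yx (page₁ yz _ no-x)  = inj₂ (no-x , yz)
    target ¬xy ¬yx (page₂ xz _ _)     = inj₁ xz
    target ¬xy ¬yx (page₃ xy _ _)     = contradiction xy ¬xy

  -- Tame vertices and pairs with a single arrow

  Tame : V → Set
  Tame x = sum (e x) ≤ u * u

  tame? : ∀ x → Dec (Tame x)
  tame? x = sum (e x) ≤? u * u

  few-bad : ∀ x → Tame x → count (λ y → u <? e x y) ≤ u
  few-bad x tame = *-cancelʳ-≤ _ u u (≤-trans (markov (λ y → u <? e x y) (e x) u (λ _ → <⇒≤)) tame)

  few-untame : count (λ x → ¬? (tame? x)) ≤ u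
  few-untame = *-cancelʳ-≤ _ u (u * u) {{m*n≢0 u u}} (≤-trans
    (markov (λ x → ¬? (tame? x)) (sum ∘ e) (u * u) (λ _ ¬t → <⇒≤ (≰⇒> ¬t)))
    (≤-trans few (≤-reflexive (*-assoc u u u))))

  Single : V → V → Set
  Single x y = (Tame x × Tame y) × (x ≢ y × e x y ≤ u) × (a x y ≡ 1 × a y x ≡ 0)

  single? : ∀ x y → Dec (Single x y)
  single? x y = (tame? x ×-dec tame? y) ×-dec ((¬? (x ≟ y) ×-dec (e x y ≤? u)) ×-dec
                ((a x y ℕ.≟ 1) ×-dec (a y x ℕ.≟ 0)))

  SingleIn : Fin k → V → V → Set
  SingleIn c y x = Single x y × O c x y

  singleIn? : ∀ c y x → Dec (SingleIn c y x)
  singleIn? c y x = single? x y ×-dec O? c x y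

  star singles : Fin k → V → ℕ
  star    c y = count (λ x → O? c x y)
  singles c y = count (singleIn? c y)

  module Slot (c : Fin k) (y : V) where

    -- Take the star of y as `A`. As x ⇒ y in colour c is the only arrow of the pair, a triple with
    -- z outside the star is neither a star edge at y nor one using y ⇒ x.
    confined : ∀ {x} → SingleIn c y x → n + sum (λ z → ι (O? c z y) * a x z) ≤ star c y + k + u + 2
    confined {x} ((_ , (x≢y , e≤u) , axy≡1 , ayx≡0) , o) =
      ≤-trans (budget x≢y (λ z → O? c z y) target) (+-monoˡ-≤ 2 (+-monoʳ-≤ (star c y + k) e≤u))
      where
      ¬yx : ∀ {c} → ¬ O c y x
      ¬yx o′ = <⇒≱ (O⇒a o′) (≤-reflexive ayx≡0)
      same : ∀ {c′} → O c′ x y → c′ ≡ c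
      same o′ = count≤1⇒unique (λ c → O? c x y) (≤-reflexive axy≡1) o′ o
      target : ∀ c′ z → ¬ O c z y → Structured (O c′) x y z → Target x y c′ z
      target c′ z ¬zy (sink₁ yx _)      = contradiction yx ¬yx
      target c′ z ¬zy (sink₂ xy zy)     with same xy
      ... | refl = contradiction zy ¬zy
      target c′ z ¬zy (sink₃ xz _)      = inj₁ xz
      target c′ z ¬zy (page₁ yz _ no-x) = inj₂ (no-x , yz)
      target c′ z ¬zy (page₂ xz _ _)    = inj₁ xz
      target c′ z ¬zy (page₃ _ yx _)    = contradiction yx ¬yx

    -- The vertices in question lie in the star of y, and `confined` bounds the arrows from x into
    -- that star.
    out-degree-singles : ∀ x → SingleIn c y x →
      count (λ z → singleIn? c y z ×-dec (1 ≤? a x z)) ≤ star c y + k + u + 2 ∸ n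
    out-degree-singles x Ix = ≤-trans (sum-mono pointwise)
      (m+n≤o⇒m≤o∸n _ (≤-trans (≤-reflexive (+-comm _ n)) (confined Ix)))
      where
      pointwise : ∀ z → ι (singleIn? c y z ×-dec (1 ≤? a x z)) ≤ ι (O? c z y) * a x z
      pointwise z = ι≤ (singleIn? c y z ×-dec (1 ≤? a x z)) λ ((_ , o) , 1≤a) → *-mono-≤ (1≤ι (O? c z y) o) 1≤a

    digraph-bound : 3 * singles c y ≤ 5 * (star c y + k + u + 2 ∸ n) + 7 * u
    digraph-bound = Digraph.conclusion (λ x z → 1 ≤ a x z) (λ x z → 1 ≤? a x z) Exc exc? u 3≤u
      adj sink (SingleIn c y) (singleIn? c y) (star c y + k + u + 2 ∸ n) out-degree-singles
      (λ x (((tame , _) , _) , _) → tame) (λ x (((tame , _) , _) , _) → few-bad x tame)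
      where
      adj : ∀ {x z} → x ≢ z → e x z ≤ u → 1 ≤ a x z ⊎ 1 ≤ a z x
      adj {x} {z} x≢z e≤u = 1≤m+n⇒1≤m⊎1≤n (a x z) (adjacent x≢z e≤u)
      sink : ∀ {x y z} → x ≢ y → y ≢ z → x ≢ z → ¬ Exc x y z → ¬ 1 ≤ a x y → 1 ≤ a z x ⊎ 1 ≤ a y z
      sink x≢y y≢z x≢z ¬exc ¬xy with covered x≢y y≢z x≢z ¬exc
      ... | c , sink₁ _ zx    = inj₁ (O⇒a zx)
      ... | c , sink₂ xy _    = contradiction (O⇒a xy) ¬xy
      ... | c , sink₃ _ yz    = inj₂ (O⇒a yz)
      ... | c , page₁ yz _ _  = inj₂ (O⇒a yz)
      ... | c , page₂ _ zx _  = inj₁ (O⇒a zx)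
      ... | c , page₃ xy _ _  = contradiction (O⇒a xy) ¬xy

    -- Makes the truncated subtraction in `digraph-bound` exact and shows that a slot has a large
    -- star.
    slot-star : 1 ≤ singles c y → n ≤ star c y + k + u + 2
    slot-star nonempty = ≤-trans (m≤m+n n _) (confined (proj₂ (witness (singleIn? c y) nonempty)))

    slot-singles : 1 ≤ singles c y → 3 * singles c y + 5 * n ≤ 5 * star c y + (5 * k + 22 * u)
    slot-singles nonempty = linear (3 * singles c y + 5 * n) (5 * star c y + (5 * k + 22 * u)) 0
      (+-mono-≤ digraph-bound (+-mono-≤ (≤-reflexive (cong (5 *_) (m∸n+n≡m (slot-star nonempty)))) (*-monoˡ-≤ 10 1≤u)))
      (eq (singles c y) n (star c y) k u (star c y + k + u + 2 ∸ n))
      where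
      eq : ∀ x n s k u h → 3 * x + 5 * n + (5 * h + 7 * u + (5 * (s + k + u + 2) + u * 10)) + 0 ≡
                           5 * s + (5 * k + 22 * u) + (3 * x + (5 * (h + n) + 1 * 10))
      eq = solve-∀

  open Slot

  -- Colours with one or two slots

  slot? : ∀ c y → Dec (1 ≤ singles c y)
  slot? c y = 1 ≤? singles c y

  slots total : Fin k → ℕ
  slots c = count (slot? c)
  total c = sum (singles c)

  stars≤n : ∀ c → sum (star c) ≤ n
  stars≤n c = begin
    sum (λ y → sum (λ x → ι (O? c x y)))  ≡⟨ sum-comm (λ y x → ι (O? c x y)) ⟩
    sum (λ x → count (O? c x))            ≤⟨ sum-≤-const (λ x → count-unique (O? c x) λ _ _ → O-functional) ⟩
    n * 1                                 ≡⟨ *-identityʳ n ⟩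
    n                                     ∎
    where open ≤-Reasoning

  -- The star of a slot has at least 6v - 3u vertices. Stars of one colour are disjoint, so three of
  -- them would not fit into n = 17v.
  slots≤2 : ∀ c → slots c ≤ 2
  slots≤2 c = ≮⇒≥ λ 2<slots → <⇒≱ 1≤u (linear u 0 (990 * u)
    (+-mono-≤ (≤-trans (≤-trans (*-monoˡ-≤ d 2<slots) (markov (slot? c) (star c) d wide)) (stars≤n c))
      (+-mono-≤ (*-monoʳ-≤ 3 d-large) (+-mono-≤ (≤-reflexive n≡17v) 1000u≤v)))
    (eq u v d n))
    where
    d = 6 * v ∸ 3 * u
    d-large : 6 * v ≤ d + 3 * u
    d-large = ≤-trans (m≤n+m∸n (6 * v) (3 * u)) (≤-reflexive (+-comm (3 * u) d))
    wide : ∀ y → 1 ≤ singles c y → d ≤ star c y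
    wide y nonempty = m≤n+o⇒m∸n≤o (6 * v) (3 * u) (linear (6 * v) (3 * u + star c y) 0
      (+-mono-≤ (slot-star c y nonempty) (+-mono-≤ k≤11v (+-mono-≤ (≤-reflexive (sym n≡17v)) (*-monoʳ-≤ 2 1≤u))))
      (eq′ u v n k (star c y)))
      where
      eq′ : ∀ u v n k s → 6 * v + (s + k + u + 2 + (11 * v + (n + 2 * u))) + 0 ≡ 3 * u + s + (n + (k + (17 * v + 2 * 1)))
      eq′ = solve-∀
    eq : ∀ u v d n → u + (n + (3 * (d + 3 * u) + (17 * v + v))) + 990 * u ≡
                     0 + (3 * d + (3 * (6 * v) + (n + u * 1000)))
    eq = solve-∀

  -- Add `slot-singles` over both slots. The two stars together have at most n vertices, and 5n +
  -- 10k - 10n is at most 25v.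
  two-slots : ∀ c → slots c ≡ 2 → 3 * total c ≤ 25 * v + 44 * u
  two-slots c two = linear (3 * total c) (25 * v + 44 * u) 0
    (+-mono-≤ summed (+-mono-≤ (*-monoʳ-≤ 5 (stars≤n c)) (+-mono-≤ (*-monoʳ-≤ 10 k≤11v) (*-monoʳ-≤ 5 (≤-reflexive (sym n≡17v))))))
    (eq (total c) n (sum (star c)) k u v)
    where
    open ≤-Reasoning
    q = 5 * k + 22 * u
    pointwise : ∀ y → 3 * singles c y + ι (slot? c y) * (5 * n) ≤ 5 * star c y + ι (slot? c y) * q
    pointwise y = split (slot? c y)
      where
      split : (d : Dec (1 ≤ singles c y)) → 3 * singles c y + ι d * (5 * n) ≤ 5 * star c y + ι d * q
      split (no empty) = ≤-trans (≤-reflexive (cong (λ s → 3 * s + 0) (n<1⇒n≡0 (≰⇒> empty)))) z≤n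
      split (yes nonempty) = ≤-trans (≤-reflexive (cong (3 * singles c y +_) (*-identityˡ (5 * n))))
        (≤-trans (slot-singles c y nonempty) (≤-reflexive (cong (5 * star c y +_) (sym (*-identityˡ q)))))
    summed : 3 * total c + 2 * (5 * n) ≤ 5 * sum (star c) + 2 * q
    summed = begin
      3 * total c + 2 * (5 * n)
        ≡⟨ cong₂ _+_ (sum-*ˡ 3 (singles c)) (trans (sum-*ʳ (5 * n) (ι ∘ slot? c)) (cong (_* (5 * n)) two)) ⟨
      sum (λ y → 3 * singles c y) + sum (λ y → ι (slot? c y) * (5 * n))
        ≡⟨ sum-+ (λ y → 3 * singles c y) (λ y → ι (slot? c y) * (5 * n)) ⟨
      sum (λ y → 3 * singles c y + ι (slot? c y) * (5 * n))
        ≤⟨ sum-mono pointwise ⟩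
      sum (λ y → 5 * star c y + ι (slot? c y) * q)
        ≡⟨ sum-+ (λ y → 5 * star c y) (λ y → ι (slot? c y) * q) ⟩
      sum (λ y → 5 * star c y) + sum (λ y → ι (slot? c y) * q)
        ≡⟨ cong₂ _+_ (sum-*ˡ 5 (star c)) (trans (sum-*ʳ q (ι ∘ slot? c)) (cong (_* q) two)) ⟩
      5 * sum (star c) + 2 * q ∎
    eq : ∀ t n s k u v →
      3 * t + (5 * s + 2 * (5 * k + 22 * u) + (5 * n + (10 * (11 * v) + 5 * n))) + 0 ≡
      25 * v + 44 * u + (3 * t + 2 * (5 * n) + (5 * s + (10 * k + 5 * (17 * v))))
    eq = solve-∀

  -- Weights and the final count

  U : V → Set
  U y = ∃ λ c → slots c ≡ 1 × 1 ≤ singles c y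

  U? : ∀ y → Dec (U y)
  U? y = any? (λ c → (slots c ℕ.≟ 1) ×-dec slot? c y)

  wt : V → ℕ
  wt y = 1 + ι (¬? (U? y))

  Λ b : ℕ
  Λ = sum wt
  b = count (λ c → slots c ℕ.≟ 2)

  U-count : count U? ≤ count (λ c → slots c ℕ.≟ 1)
  U-count = begin
    count U?
      ≤⟨ sum-mono pointwise ⟩
    sum (λ y → sum (λ c → ι (slots c ℕ.≟ 1) * ι (slot? c y)))
      ≡⟨ trans (sum-comm (λ y c → ι (slots c ℕ.≟ 1) * ι (slot? c y))) (over-sum (λ c → slots c ℕ.≟ 1) (λ c y → ι (slot? c y))) ⟩
    sum (λ c → ι (slots c ℕ.≟ 1) * slots c)
      ≤⟨ sum-over (λ c → slots c ℕ.≟ 1) (λ _ → ≤-reflexive) ⟩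
    count (λ c → slots c ℕ.≟ 1) * 1
      ≡⟨ *-identityʳ _ ⟩
    count (λ c → slots c ℕ.≟ 1) ∎
    where
    open ≤-Reasoning
    pointwise : ∀ y → ι (U? y) ≤ sum (λ c → ι (slots c ℕ.≟ 1) * ι (slot? c y))
    pointwise y = ι≤ (U? y) λ (c , one , slot) →
      ≤-trans (*-mono-≤ (1≤ι (slots c ℕ.≟ 1) one) (1≤ι (slot? c y) slot)) (term≤sum (λ c → ι (slots c ℕ.≟ 1) * ι (slot? c y)) c)

  one+two : count (λ c → slots c ℕ.≟ 1) + b ≤ k
  one+two = begin
    count (λ c → slots c ℕ.≟ 1) + b
      ≡⟨ sum-+ (λ c → ι (slots c ℕ.≟ 1)) (λ c → ι (slots c ℕ.≟ 2)) ⟨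
    sum (λ c → ι (slots c ℕ.≟ 1) + ι (slots c ℕ.≟ 2))
      ≤⟨ sum-≤-const (λ c → exclusive (slots c ℕ.≟ 1) (slots c ℕ.≟ 2)) ⟩
    k * 1
      ≡⟨ *-identityʳ k ⟩
    k ∎
    where
    open ≤-Reasoning
    exclusive : ∀ {s} (d : Dec (s ≡ 1)) (d′ : Dec (s ≡ 2)) → ι d + ι d′ ≤ 1
    exclusive (yes refl) (no _) = ≤-refl
    exclusive (no _) d′ = ι≤1 d′

  -- At most k - b colours have exactly one slot, hence at most k - b vertices have weight 1.
  Λ-large : b + 2 * n ≤ Λ + k
  Λ-large = linear (b + 2 * n) (Λ + k) 0
    (+-mono-≤ U-count (+-mono-≤ one+two (≤-reflexive (sym (cong₂ _+_ Λ≡ partition)))))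
    (eq b n Λ k (count U?) (count (λ c → slots c ℕ.≟ 1)) (count (λ y → ¬? (U? y))))
    where
    Λ≡ : Λ ≡ n + count (λ y → ¬? (U? y))
    Λ≡ = trans (sum-+ (λ _ → 1) (λ y → ι (¬? (U? y)))) (cong (_+ count (λ y → ¬? (U? y))) (trans (sum-const n 1) (*-identityʳ n)))
    partition : count U? + count (λ y → ¬? (U? y)) ≡ n
    partition = trans (sym (sum-+ (ι ∘ U?) (λ y → ι (¬? (U? y)))))
      (trans (sum-cong (λ y → ι+ι¬ (U? y))) (trans (sum-const n 1) (*-identityʳ n)))
    eq : ∀ b n Λ k p o m → b + 2 * n + (o + (k + (Λ + (p + m)))) + 0 ≡ Λ + k + (p + (o + b + (n + m + n)))
    eq = solve-∀

  s : V → V → ℕ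
  s x y = ι (¬? (U? y)) * ι (single? x y)

  S : ℕ
  S = sum (λ y → sum (λ x → s x y))

  -- A single arrow of colour c into y makes y a slot of c. Since y has weight 2, c is not a
  -- one-slot colour, so it has exactly two slots.
  S-small : 3 * S ≤ b * (25 * v + 44 * u)
  S-small = begin
    3 * S
      ≤⟨ *-monoʳ-≤ 3 (sum₂-mono pointwise) ⟩
    3 * sum (λ y → sum (λ x → sum (λ c → f c y x)))
      ≡⟨ cong (3 *_) (trans (sum-cong (λ y → sum-comm (λ x c → f c y x))) (sum-comm (λ y c → sum (f c y)))) ⟩
    3 * sum (λ c → sum (λ y → sum (f c y)))
      ≡⟨ cong (3 *_) (sum-cong (λ c → trans (sum-cong (λ y → sum-*ˡ (ι (slots c ℕ.≟ 2)) (λ x → ι (singleIn? c y x))))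
           (sum-*ˡ (ι (slots c ℕ.≟ 2)) (singles c)))) ⟩
    3 * sum (λ c → ι (slots c ℕ.≟ 2) * total c)
      ≡⟨ sum-*ˡ 3 (λ c → ι (slots c ℕ.≟ 2) * total c) ⟨
    sum (λ c → 3 * (ι (slots c ℕ.≟ 2) * total c))
      ≡⟨ sum-cong (λ c → commute 3 (ι (slots c ℕ.≟ 2)) (total c)) ⟩
    sum (λ c → ι (slots c ℕ.≟ 2) * (3 * total c))
      ≤⟨ sum-over (λ c → slots c ℕ.≟ 2) two-slots ⟩
    b * (25 * v + 44 * u) ∎
    where
    open ≤-Reasoning
    commute : ∀ a b c → a * (b * c) ≡ b * (a * c)
    commute = solve-∀
    f : Fin k → V → V → ℕ
    f c y x = ι (slots c ℕ.≟ 2) * ι (singleIn? c y x)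
    pointwise : ∀ y x → s x y ≤ sum (λ c → f c y x)
    pointwise y x = ι*≤ (¬? (U? y)) λ ¬U → ι≤ (single? x y) (found ¬U)
      where
      found : ¬ U y → Single x y → 1 ≤ sum (λ c → f c y x)
      found ¬U single@(_ , _ , axy≡1 , _) with witness (λ c → O? c x y) (≤-reflexive (sym axy≡1))
      ... | c , o = ≤-trans (*-mono-≤ (1≤ι (slots c ℕ.≟ 2) two) (1≤ι (singleIn? c y x) (single , o)))
                            (term≤sum (λ c → f c y x) c)
        where
        nonempty : 1 ≤ singles c y
        nonempty = ≤-trans (1≤ι (singleIn? c y x) (single , o)) (term≤sum (λ x → ι (singleIn? c y x)) x)
        1≤slots : 1 ≤ slots c
        1≤slots = ≤-trans (1≤ι (slot? c y) nonempty) (term≤sum (λ y → ι (slot? c y)) y)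
        two : slots c ≡ 2
        two = ≤-antisym (slots≤2 c) (≤∧≢⇒< 1≤slots (λ one → ¬U (c , sym one , nonempty)))

  -- The last two terms are restricted to tame vertices so that `few-bad` bounds every row.
  bad : V → V → ℕ
  bad x y = ι (x ≟ y) + (ι (¬? (tame? x)) + (ι (¬? (tame? y)) +
            (ι (tame? x ×-dec (u <? e x y)) + ι (tame? y ×-dec (u <? e y x)))))

  bad-or-good : ∀ x y → 1 ≤ bad x y ⊎ ((Tame x × Tame y) × x ≢ y × e x y ≤ u × e y x ≤ u)
  bad-or-good x y = split (x ≟ y) (tame? x) (tame? y) (u <? e x y) (u <? e y x)
    where
    split : (p : Dec (x ≡ y)) (q : Dec (Tame x)) (r : Dec (Tame y)) (s : Dec (u < e x y)) (t : Dec (u < e y x)) →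
      1 ≤ ι p + (ι (¬? q) + (ι (¬? r) + (ι (q ×-dec s) + ι (r ×-dec t)))) ⊎
      ((Tame x × Tame y) × x ≢ y × e x y ≤ u × e y x ≤ u)
    split (yes _) _ _ _ _ = inj₁ (s≤s z≤n)
    split (no _) (no _) _ _ _ = inj₁ (s≤s z≤n)
    split (no _) (yes _) (no _) _ _ = inj₁ (s≤s z≤n)
    split (no _) (yes _) (yes _) (yes _) _ = inj₁ (s≤s z≤n)
    split (no _) (yes _) (yes _) (no _) (yes _) = inj₁ (s≤s z≤n)
    split (no p) (yes q) (yes r) (no s) (no t) = inj₂ ((q , r) , p , ≮⇒≥ s , ≮⇒≥ t)

  Bad : ℕ
  Bad = sum (λ x → sum (bad x))

  Bad-small : Bad ≤ n * (1 + 4 * u)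
  Bad-small = begin
    Bad
      ≡⟨ trans (sum₂-+ b₁ (λ x y → b₂ x y + (b₃ x y + (b₄ x y + b₄ y x)))) (cong (sum₂ b₁ +_)
           (trans (sum₂-+ b₂ (λ x y → b₃ x y + (b₄ x y + b₄ y x))) (cong (sum₂ b₂ +_)
             (trans (sum₂-+ b₃ (λ x y → b₄ x y + b₄ y x)) (cong (sum₂ b₃ +_) (sum₂-+ b₄ (λ x y → b₄ y x))))))) ⟩
    sum₂ b₁ + (sum₂ b₂ + (sum₂ b₃ + (sum₂ b₄ + sum₂ (λ x y → b₄ y x))))
      ≤⟨ +-mono-≤ b₁≤ (+-mono-≤ (≤-trans (≤-reflexive (sum-comm b₂)) b₃≤) (+-mono-≤ b₃≤
           (+-mono-≤ b₄≤ (≤-trans (≤-reflexive (sum-comm (λ x y → b₄ y x))) b₄≤)))) ⟩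
    n * 1 + (n * u + (n * u + (n * u + n * u)))
      ≡⟨ collect n u ⟩
    n * (1 + 4 * u) ∎
    where
    open ≤-Reasoning
    sum₂ : (V → V → ℕ) → ℕ
    sum₂ f = sum (λ x → sum (f x))
    b₁ b₂ b₃ b₄ : V → V → ℕ
    b₁ x y = ι (x ≟ y)
    b₂ x y = ι (¬? (tame? x))
    b₃ x y = ι (¬? (tame? y))
    b₄ x y = ι (tame? x ×-dec (u <? e x y))
    b₁≤ : sum₂ b₁ ≤ n * 1
    b₁≤ = sum-≤-const {f = λ x → sum (b₁ x)} (λ x → count-unique (x ≟_) λ { _ _ refl refl → refl })
    b₃≤ : sum₂ b₃ ≤ n * u
    b₃≤ = sum-≤-const {f = λ x → sum (b₃ x)} (λ _ → few-untame)
    row : ∀ x → sum (b₄ x) ≤ u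
    row x = begin
      sum (b₄ x)                                    ≡⟨ sum-cong (λ y → ι-× (tame? x) (u <? e x y)) ⟩
      sum (λ y → ι (tame? x) * ι (u <? e x y))      ≡⟨ sum-*ˡ (ι (tame? x)) (λ y → ι (u <? e x y)) ⟩
      ι (tame? x) * count (λ y → u <? e x y)        ≤⟨ ι*≤ (tame? x) (few-bad x) ⟩
      u                                             ∎
    b₄≤ : sum₂ b₄ ≤ n * u
    b₄≤ = sum-≤-const {f = λ x → sum (b₄ x)} row
    collect : ∀ n u → n * 1 + (n * u + (n * u + (n * u + n * u))) ≡ n * (1 + 4 * u)
    collect = solve-∀

  cost : ∀ x y → wt x * wt y ≤ wt x * a x y + (wt y * a y x + (2 * s x y + (2 * s y x + 4 * bad x y)))
  cost x y with bad-or-good x y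
  ... | inj₁ 1≤bad = ≤-trans (*-mono-≤ (s≤s (ι≤1 (¬? (U? x)))) (s≤s (ι≤1 (¬? (U? y)))))
    (right (wt x * a x y) (right (wt y * a y x) (right (2 * s x y) (right (2 * s y x) (*-monoʳ-≤ 4 1≤bad)))))
  ... | inj₂ ((tx , ty) , x≢y , exy , eyx) =
    min-cost (a x y) (a y x) (ι (single? x y)) (ι (single? y x)) (4 * bad x y)
      (ι≤1 (¬? (U? x))) (ι≤1 (¬? (U? y))) (adjacent x≢y exy)
      (λ a≡1 b≡0 → 1≤ι (single? x y) ((tx , ty) , (x≢y , exy) , a≡1 , b≡0))
      (λ b≡1 a≡0 → 1≤ι (single? y x) ((ty , tx) , (≢-sym x≢y , eyx) , b≡1 , a≡0))

  main : Λ * Λ ≤ Λ * k + (Λ * k + (2 * S + (2 * S + 4 * Bad)))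
  main = weighted-count wt a s bad out-degree cost

  impossible : ⊥
  impossible = <⇒≱ (*-mono-≤ 1≤v 1≤v) (quadratic {b} {v} {Λ} lower upper)
    where
    1≤v : 1 ≤ v
    1≤v = ≤-trans (≤-trans 1≤u (m≤m*n u 1000)) 1000u≤v
    lower : b + 23 * v ≤ Λ
    lower = linear (b + 23 * v) Λ 0
      (+-mono-≤ Λ-large (+-mono-≤ k≤11v (*-monoʳ-≤ 2 (≤-reflexive (sym n≡17v))))) (eq b v Λ k n)
      where
      eq : ∀ b v Λ k n → b + 23 * v + (Λ + k + (11 * v + 2 * n)) + 0 ≡ Λ + (b + 2 * n + (k + 2 * (17 * v)))
      eq = solve-∀
    -- The errors 880bu from `S` and 5100vu from `Bad` are absorbed into bv and 6v², as 1000u ≤ v.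
    upper : 15 * (Λ * Λ) ≤ 330 * v * Λ + (501 * (b * v) + 6 * (v * v))
    upper = linear (15 * (Λ * Λ)) (330 * v * Λ + (501 * (b * v) + 6 * (v * v))) (120 * (b * u) + 900 * (v * u))
      (+-mono-≤ (*-monoʳ-≤ 15 main) (+-mono-≤ (*-monoʳ-≤ 20 S-small) (+-mono-≤ (*-monoʳ-≤ 60 Bad-small)
        (+-mono-≤ (*-monoʳ-≤ (30 * Λ) k≤11v) (+-mono-≤ (*-monoʳ-≤ b 1000u≤v) (+-mono-≤ (*-monoʳ-≤ (6 * v) 1000u≤v)
          (+-mono-≤ (*-monoˡ-≤ (60 * (1 + 4 * u)) (≤-reflexive n≡17v)) (*-monoʳ-≤ (1020 * v) 1≤u))))))))
      (eq Λ k S Bad b u v n)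
      where
      eq : ∀ Λ k S B b u v n →
        15 * (Λ * Λ) + (15 * (Λ * k + (Λ * k + (2 * S + (2 * S + 4 * B)))) + (20 * (b * (25 * v + 44 * u)) +
          (60 * (n * (1 + 4 * u)) + (30 * Λ * (11 * v) + (b * v + (6 * v * v + (17 * v * (60 * (1 + 4 * u)) + 1020 * v * u))))))) +
          (120 * (b * u) + 900 * (v * u)) ≡
        330 * v * Λ + (501 * (b * v) + 6 * (v * v)) + (15 * (Λ * Λ) + (20 * (3 * S) + (60 * B + (30 * Λ * k +
          (b * (u * 1000) + (6 * v * (u * 1000) + (n * (60 * (1 + 4 * u)) + 1020 * v * 1)))))))
      eq = solve-∀

-- Colourings without a monochromatic loose path

-- For the order proofs that a colouring takes as arguments: since they are unique, it suffices to
-- test the one found.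
Σ-dec : {A : Set} {B : A → Set} → Irrelevant A → Dec A → (∀ a → Dec (B a)) → Dec (Σ A B)
Σ-dec irrelevant (no ¬a) B? = no (¬a ∘ proj₁)
Σ-dec {B = B} irrelevant (yes a) B? = map′ (a ,_) (λ (a′ , b) → subst B (irrelevant a′ a) b) (B? a)

module _ {n : ℕ} where

  isPerm? : (x y z p q r : Fin n) → Dec (IsPerm x y z p q r)
  isPerm? x y z p q r = map′ to from
    (match? x y z ⊎-dec (match? x z y ⊎-dec (match? y x z ⊎-dec (match? y z x ⊎-dec (match? z x y ⊎-dec match? z y x)))))
    where
    Eq : Fin n → Fin n → Fin n → Set
    Eq a b c = p ≡ a × q ≡ b × r ≡ c
    match? : ∀ a b c → Dec (Eq a b c)
    match? a b c = p ≟ a ×-dec (q ≟ b ×-dec r ≟ c)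
    to : Eq x y z ⊎ Eq x z y ⊎ Eq y x z ⊎ Eq y z x ⊎ Eq z x y ⊎ Eq z y x → IsPerm x y z p q r
    to (inj₁ (refl , refl , refl)) = xyz
    to (inj₂ (inj₁ (refl , refl , refl))) = xzy
    to (inj₂ (inj₂ (inj₁ (refl , refl , refl)))) = yxz
    to (inj₂ (inj₂ (inj₂ (inj₁ (refl , refl , refl))))) = yzx
    to (inj₂ (inj₂ (inj₂ (inj₂ (inj₁ (refl , refl , refl)))))) = zxy
    to (inj₂ (inj₂ (inj₂ (inj₂ (inj₂ (refl , refl , refl)))))) = zyx
    from : IsPerm x y z p q r → Eq x y z ⊎ Eq x z y ⊎ Eq y x z ⊎ Eq y z x ⊎ Eq z x y ⊎ Eq z y x
    from xyz = inj₁ (refl , refl , refl)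
    from xzy = inj₂ (inj₁ (refl , refl , refl))
    from yxz = inj₂ (inj₂ (inj₁ (refl , refl , refl)))
    from yzx = inj₂ (inj₂ (inj₂ (inj₁ (refl , refl , refl))))
    from zxy = inj₂ (inj₂ (inj₂ (inj₂ (inj₁ (refl , refl , refl)))))
    from zyx = inj₂ (inj₂ (inj₂ (inj₂ (inj₂ (refl , refl , refl)))))

module Edges {n k : ℕ} (χ : Colouring n k) where

  E : Fin k → Fin n → Fin n → Fin n → Set
  E = EdgeHasColour χ

  E? : ∀ c x y z → Dec (E c x y z)
  E? c x y z = any? λ p → any? λ q → any? λ r →
    Σ-dec Fin.<-irrelevant (p Fin.<? q) λ pq → Σ-dec Fin.<-irrelevant (q Fin.<? r) λ qr →
    isPerm? x y z p q r ×-dec (χ p q r pq qr ≟ c)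

  E-swap : ∀ {c x y z} → E c x y z → E c y x z
  E-swap (p , q , r , pq , qr , π , eq) = p , q , r , pq , qr , swap π , eq
    where
    swap : ∀ {x y z p q r} → IsPerm x y z p q r → IsPerm {n} y x z p q r
    swap xyz = yxz
    swap xzy = yzx
    swap yxz = xyz
    swap yzx = xzy
    swap zxy = zyx
    swap zyx = zxy

  E-turn : ∀ {c x y z} → E c x y z → E c y z x
  E-turn (p , q , r , pq , qr , π , eq) = p , q , r , pq , qr , turn π , eq
    where
    turn : ∀ {x y z p q r} → IsPerm x y z p q r → IsPerm {n} y z x p q r
    turn xyz = zxy
    turn xzy = zyx
    turn yxz = xzy
    turn yzx = xyz
    turn zxy = yzx
    turn zyx = yxz

  E-irr : ∀ {c x y z} → E c x y z → x ≢ y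
  E-irr (p , q , r , pq , qr , π , _) = distinct π
    where
    distinct : ∀ {x y z} → IsPerm x y z p q r → x ≢ y
    distinct xyz = Fin.<⇒≢ pq
    distinct xzy = Fin.<⇒≢ (Fin.<-trans pq qr)
    distinct yxz = ≢-sym (Fin.<⇒≢ pq)
    distinct yzx = ≢-sym (Fin.<⇒≢ (Fin.<-trans pq qr))
    distinct zxy = Fin.<⇒≢ qr
    distinct zyx = ≢-sym (Fin.<⇒≢ qr)

  E-total : ∀ {x y z} → x ≢ y → y ≢ z → x ≢ z → ∃ λ c → E c x y z
  E-total {x} {y} {z} x≢y y≢z x≢z with Fin.<-cmp x y | Fin.<-cmp y z | Fin.<-cmp x z
  ... | tri≈ _ x≡y _ | _            | _            = contradiction x≡y x≢y
  ... | _            | tri≈ _ y≡z _ | _            = contradiction y≡z y≢z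
  ... | _            | _            | tri≈ _ x≡z _ = contradiction x≡z x≢z
  ... | tri< x<y _ _ | tri< y<z _ _ | _            = _ , x , y , z , x<y , y<z , xyz , refl
  ... | tri< x<y _ _ | tri> _ _ z<y | tri< x<z _ _ = _ , x , z , y , x<z , z<y , xzy , refl
  ... | tri< x<y _ _ | tri> _ _ z<y | tri> _ _ z<x = _ , z , x , y , z<x , x<y , zxy , refl
  ... | tri> _ _ y<x | tri< y<z _ _ | tri< x<z _ _ = _ , y , x , z , y<x , x<z , yxz , refl
  ... | tri> _ _ y<x | tri< y<z _ _ | tri> _ _ z<x = _ , y , z , x , y<z , z<x , yzx , refl
  ... | tri> _ _ y<x | tri> _ _ z<y | _            = _ , z , y , x , z<y , y<x , zyx , refl

  Path : Fin k → (a b c d e f g : Fin n) → Set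
  Path i a b c d e f g = (E i a b c × E i c d e × E i e f g) ×
    All (a ≢_) (d ∷ e ∷ f ∷ g ∷ []) × All (b ≢_) (d ∷ e ∷ f ∷ g ∷ []) ×
    All (c ≢_) (f ∷ g ∷ []) × All (d ≢_) (f ∷ g ∷ [])

  path? : ∀ i a b c d e f g → Dec (Path i a b c d e f g)
  path? i a b c d e f g = (E? i a b c ×-dec (E? i c d e ×-dec E? i e f g)) ×-dec
    (apart a _ ×-dec (apart b _ ×-dec (apart c _ ×-dec apart d _)))
    where
    apart : ∀ x L → Dec (All (x ≢_) L)
    apart x = All.all? (λ y → ¬? (x ≟ y))

  path⇒mono : ∀ {i a b c d e f g} → Path i a b c d e f g → HasMonoLoosePath χ
  path⇒mono {i} {a} {b} {c} {d} {e} {f} {g}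
    ((abc , cde , efg) , ad ∷ ae ∷ af ∷ ag ∷ [] , bd ∷ be ∷ bf ∷ bg ∷ [] , cf ∷ cg ∷ [] , df ∷ dg ∷ []) =
    lookup vs , (λ {i} {j} → lookup-injective distinct i j) , i , abc , cde , efg
    where
    vs = a ∷ b ∷ c ∷ d ∷ e ∷ f ∷ g ∷ []
    E-irr₁₃ : ∀ {i x y z} → E i x y z → x ≢ z
    E-irr₁₃ h = ≢-sym (E-irr (E-turn (E-turn h)))
    distinct : Unique vs
    distinct =
      (E-irr abc ∷ E-irr₁₃ abc ∷ ad ∷ ae ∷ af ∷ ag ∷ []) ∷
      (E-irr (E-turn abc) ∷ bd ∷ be ∷ bf ∷ bg ∷ []) ∷
      (E-irr cde ∷ E-irr₁₃ cde ∷ cf ∷ cg ∷ []) ∷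
      (E-irr (E-turn cde) ∷ df ∷ dg ∷ []) ∷
      (E-irr efg ∷ E-irr₁₃ efg ∷ []) ∷
      (E-irr (E-turn efg) ∷ []) ∷ [] ∷ []

  -- A finite search, which keeps the case distinction constructive.
  mono-or-free : HasMonoLoosePath χ ⊎ (∀ i → LooseFree (E i))
  mono-or-free with (any? λ i → any? λ a → any? λ b → any? λ c → any? λ d → any? λ e → any? λ f → any? (path? i a b c d e f))
  ... | yes (_ , _ , _ , _ , _ , _ , _ , _ , path) = inj₁ (path⇒mono path)
  ... | no  none = inj₂ λ i abc cde efg a b c d → none (i , _ , _ , _ , _ , _ , _ , _ , (abc , cde , efg) , a , b , c , d)

-- Exceptional triples of all colours and the choice of constants

sum₃-comm : ∀ {n k} (f : Fin k → Fin n → Fin n → Fin n → ℕ) →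
  sum₃ (λ x y z → sum (λ c → f c x y z)) ≡ sum (λ c → sum₃ (f c))
sum₃-comm f = trans (sum-cong λ x → trans (sum-cong λ y → sum-comm (λ z c → f c x y z)) (sum-comm (λ y c → sum (f c x y))))
                    (sum-comm (λ x c → sum (λ y → sum (f c x y))))

-- For n = put and k ≤ qut. Half of the right side pays for the busy vertices once `C` is large, the
-- other half for the rest once `u` is large in terms of `C` and `D`.
exceptional-budget : ∀ p q t C D u {k} → k ≤ q * (u * t) →
  2 * (q * t * 6 * (2 * (p * t) * (p * t))) ≤ C → 2 * (q * t * 6 * (p * t) * D) ≤ u →
  k * (6 * (p * (u * t) * (C * D) + 2 * (p * (u * t)) * (p * (u * t)))) ≤ C * (u * u * u)
exceptional-budget p q t C D u {k} k≤ C-large u-large = *-cancelˡ-≤ 2 (begin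
  2 * (k * w)                     ≤⟨ *-monoʳ-≤ 2 (*-monoˡ-≤ w k≤) ⟩
  2 * (q * (u * t) * w)           ≡⟨ eq p q t C D u ⟩
  2 * (q * t * 6 * (p * t) * D) * (C * u * u) + 2 * (q * t * 6 * (2 * (p * t) * (p * t))) * (u * u * u)
    ≤⟨ +-mono-≤ (*-monoˡ-≤ (C * u * u) u-large) (*-monoˡ-≤ (u * u * u) C-large) ⟩
  u * (C * u * u) + C * (u * u * u)  ≡⟨ eq′ C u ⟩
  2 * (C * (u * u * u))           ∎)
  where
  open ≤-Reasoning
  w = 6 * (p * (u * t) * (C * D) + 2 * (p * (u * t)) * (p * (u * t)))
  eq : ∀ p q t C D u →
    2 * (q * (u * t) * (6 * (p * (u * t) * (C * D) + 2 * (p * (u * t)) * (p * (u * t))))) ≡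
    2 * (q * t * 6 * (p * t) * D) * (C * u * u) + 2 * (q * t * 6 * (2 * (p * t) * (p * t))) * (u * u * u)
  eq = solve-∀
  eq′ : ∀ C u → u * (C * u * u) + C * (u * u * u) ≡ 2 * (C * (u * u * u))
  eq′ = solve-∀

arrows : ∀ {n k} C u → 5 ≤ C → 3 ≤ u → n ≡ 17 * (u * 1000) → k ≤ 11 * (u * 1000) →
  k * (6 * (n * (C * (14 * C + 12)) + 2 * n * n)) ≤ C * (u * u * u) → Arrows n k
arrows {n} {k} C u 5≤C 3≤u n≡ k≤ room χ with Edges.mono-or-free χ
... | inj₁ found = found
... | inj₂ free  = ⊥-elim (Colours.impossible O (λ c → Class.O? c) (λ {c} → Class.O-functional c) (λ {c} → Class.O-irr c)
    Exc exc? covered u (u * 1000) 3≤u ≤-refl n≡ k≤ few)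
  where
  open Edges χ
  module Class (c : Fin k) = ColourClass (E c) (E? c) E-swap E-turn E-irr (free c) C 5≤C
  O : Fin k → Fin n → Fin n → Set
  O c = Class.O c
  Exc : Fin n → Fin n → Fin n → Set
  Exc x y z = ∃ λ c → Class.Exceptional c x y z
  exc? : ∀ x y z → Dec (Exc x y z)
  exc? x y z = any? (λ c → Class.exceptional? c x y z)
  covered : ∀ {x y z} → x ≢ y → y ≢ z → x ≢ z → ¬ Exc x y z → ∃ λ c → Structured (O c) x y z
  covered {x} {y} {z} x≢y y≢z x≢z ¬exc with E-total x≢y y≢z x≢z
  ... | c , h = c , decidable-stable (structured? (Class.O? c) x y z) λ ¬s → ¬exc (c , h , ¬s)
  few : sum₃ (λ x y z → ι (exc? x y z)) ≤ u * u * u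
  few = *-cancelˡ-≤ C {{>-nonZero (≤-trans (s≤s z≤n) 5≤C)}} (begin
    C * sum₃ (λ x y z → ι (exc? x y z))
      ≤⟨ *-monoʳ-≤ C (sum₃-mono λ x y z → ι≤ (exc? x y z) λ (c , exc) →
           ≤-trans (1≤ι (Class.exceptional? c x y z) exc) (term≤sum (λ c → ι (Class.exceptional? c x y z)) c)) ⟩
    C * sum₃ (λ x y z → sum (λ c → ι (Class.exceptional? c x y z)))
      ≡⟨ cong (C *_) (sum₃-comm (λ c x y z → ι (Class.exceptional? c x y z))) ⟩
    C * sum (λ c → sum₃ (λ x y z → ι (Class.exceptional? c x y z)))
      ≡⟨ sum-*ˡ C (λ c → sum₃ (λ x y z → ι (Class.exceptional? c x y z))) ⟨
    sum (λ c → C * sum₃ (λ x y z → ι (Class.exceptional? c x y z)))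
      ≤⟨ sum-≤-const Class.exceptional-count ⟩
    k * (6 * (n * (C * (14 * C + 12)) + 2 * n * n))
      ≤⟨ room ⟩
    C * (u * u * u) ∎)
    where open ≤-Reasoning

quotient : ∀ k o .{{_ : NonZero o}} → ∃ λ q → k ≤ q * o + o × q * o ≤ k × (∀ m → m * o ≤ k → m ≤ q)
quotient k o = k / o ,
  (begin
    k                  ≡⟨ m≡m%n+[m/n]*n k o ⟩
    k % o + k / o * o  ≤⟨ +-monoˡ-≤ (k / o * o) (<⇒≤ (m%n<n k o)) ⟩
    o + k / o * o      ≡⟨ +-comm o (k / o * o) ⟩
    k / o * o + o      ∎) ,
  m/n*n≤m k o ,
  λ m m*o≤k → ≤-trans (≤-reflexive (sym (m*n/n≡m m o))) (/-monoˡ-≤ o m*o≤k)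
  where open ≤-Reasoning

-- Take u one above the quotient q of k by 11000. Rounding up costs 17000 in n, whereas 1.546 ·
-- 11000 = 17006 gains 6 for each unit of q, so q ≥ 3000 suffices.
scale : ∀ u₀ k → k ≥ (u₀ + 3000) * 11000 →
  ∃ λ u → u₀ ≤ u × 3 ≤ u × k ≤ 11 * (u * 1000) × 1000 * (17 * (u * 1000)) < 1546 * k
scale u₀ k k≥ =
  let q , k≤ , ≤k , largest = quotient k 11000
      q≥ = largest (u₀ + 3000) k≥
      3000≤q = ≤-trans (m≤n+m 3000 u₀) q≥
  in suc q , m≤n⇒m≤1+n (≤-trans (m≤m+n u₀ 3000) q≥) , m≤n⇒m≤1+n (≤-trans (m≤m+n 3 2997) 3000≤q) ,
     upper q k≤ , lower q 3000≤q ≤k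
  where
  open ≤-Reasoning
  upper : ∀ q → k ≤ q * 11000 + 11000 → k ≤ 11 * (suc q * 1000)
  upper q k≤ = ≤-trans k≤ (≤-reflexive (eq q))
    where
    eq : ∀ q → q * 11000 + 11000 ≡ 11 * (suc q * 1000)
    eq = solve-∀
  lower : ∀ q → 3000 ≤ q → q * 11000 ≤ k → 1000 * (17 * (suc q * 1000)) < 1546 * k
  lower q 3000≤q ≤k = begin-strict
    1000 * (17 * (suc q * 1000))  ≡⟨ cong (1000 *_) (eq₁ q) ⟩
    1000 * (q * 17000 + 17000)    <⟨ *-monoʳ-< 1000 (linear (suc (q * 17000 + 17000)) (q * 17006) 999 (*-monoˡ-≤ 6 3000≤q) (eq₂ q)) ⟩
    1000 * (q * 17006)            ≡⟨ eq₃ q ⟩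
    1546 * (q * 11000)            ≤⟨ *-monoʳ-≤ 1546 ≤k ⟩
    1546 * k                      ∎
    where
    eq₁ : ∀ q → 17 * (suc q * 1000) ≡ q * 17000 + 17000
    eq₁ = solve-∀
    eq₂ : ∀ q → suc (q * 17000 + 17000) + q * 6 + 999 ≡ q * 17006 + 3000 * 6
    eq₂ = solve-∀
    eq₃ : ∀ q → 1000 * (q * 17006) ≡ 1546 * (q * 11000)
    eq₃ = solve-∀

theorem1 : ∃ λ (k₀ : ℕ) → ∀ (k : ℕ) → k ≥ k₀ →
    ∃ λ (n : ℕ) → (1000 * n < 1546 * k) × Arrows n k
theorem1 = (u₀ + 3000) * 11000 , λ k k≥ →
  let u , u₀≤u , 3≤u , k≤ , n< = scale u₀ k k≥
  in 17 * (u * 1000) , n< , arrows C u (s≤s (s≤s (s≤s (s≤s (s≤s z≤n))))) 3≤u refl k≤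
       (exceptional-budget 17 11 1000 C (14 * C + 12) u k≤ ≤-refl u₀≤u)
  where
  C u₀ : ℕ
  -- The least values that `exceptional-budget` admits for p = 17, q = 11, t = 1000. The heaviness
  -- threshold `C` is fixed first and `u₀` depends on it.
  C  = 2 * (11 * 1000 * 6 * (2 * (17 * 1000) * (17 * 1000)))
  u₀ = 2 * (11 * 1000 * 6 * (17 * 1000) * (14 * C + 12))
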